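{- The family of languages $L(M)$, where $M$ ranges over all AARMs, is precisely the family of recursively enumerable languages.
   Context: For a finite alphabet $\Gamma$ and a symbol $\# \notin \Gamma$, the convolution $conv(x,y)$ of $x,y\in\Gamma^*$ is the string of length $\max(|x|,|y|)$ over $(\Gamma\cup\{\#\})^2$ whose $i$-th letter is $(x'_i,y'_i)$, where $x',y'$ are $x,y$ padded on the right with $\#$ to equal length. A relation $J\subseteq\Gamma^*\times\Gamma^*$ is automatic if $\{conv(x,y):(x,y)\in J\}$ is regular, and bounded if there is a constant $c$ with $||y|-|x||\le c$ for all $(x,y)\in J$. An Alternating Automatic Register Machine (AARM) $M=(\Gamma,\Sigma,A,B)$ consists of a register alphabet $\Gamma$, an input alphabet $\Sigma\subseteq\Gamma$ and two finite sets $A,B$ of instructions, each a bounded automatic relation $J\subseteq\Gamma^*\times\Gamma^*$. On input $w\in\Sigma^*$ the register initially contains $w$, and two players, Anke and Boris, move alternately, Anke first: on her turn, if the register contains $r$, Anke chooses $J\in A$ and some $x$ with $(r,x)\in J$, and the register then contains $x$; Boris moves in the same way using instructions from $B$. If the player to move has no instruction $J$ in their set with some $x$ such that $(r,x)\in J$, the game ends and the player who made the last move wins; an infinite play is a draw. $M$ accepts $w$ if Anke has a winning strategy, and $L(M)=\{w\in\Sigma^*: M \text{ accepts } w\}$ (the language recognised by $M$). -}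

module Defs where

open import Data.Nat using (ℕ; zero; suc; _+_; _≤_)
open import Data.Fin using (Fin)
import Data.Fin as Fin
open import Data.Bool using (Bool; true; false)
open import Data.List using (List; []; _∷_; length; foldl)
import Data.List
open import Data.List.Membership.Propositional using (_∈_)
open import Data.Maybe using (Maybe; just; nothing)
open import Data.Product using (_×_; _,_; ∃)
open import Data.Sum using (_⊎_; inj₁; inj₂)
open import Function.Definitions using (Injective)
open import Relation.Binary.PropositionalEquality using (_≡_)
open import Function.Bundles using (_⇔_)

-- Words and convolution.  The padding symbol # is `nothing`.

Word : ℕ → Set
Word g = List (Fin g)

conv : {A : Set} → List A → List A → List (Maybe A × Maybe A)
conv []       []       = []
conv []       (b ∷ ys) = (nothing , just b) ∷ conv [] ys
conv (a ∷ xs) []       = (just a , nothing) ∷ conv xs []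
conv (a ∷ xs) (b ∷ ys) = (just a , just b) ∷ conv xs ys

record DFA (Σ : Set) : Set where
  field
    nStates : ℕ
    start   : Fin (suc nStates)
    δ       : Fin (suc nStates) → Σ → Fin (suc nStates)
    final   : Fin (suc nStates) → Bool

accepts : {Σ : Set} → DFA Σ → List Σ → Bool
accepts D w = DFA.final D (foldl (DFA.δ D) (DFA.start D) w)

-- Instructions: bounded automatic relations on Γ* (Γ = Fin g).
-- An automatic relation is given by a DFA recognising {conv(x,y)}.

ConvAlph : ℕ → Set
ConvAlph g = Maybe (Fin g) × Maybe (Fin g)

record Instruction (g : ℕ) : Set where
  field
    auto    : DFA (ConvAlph g)
    bound   : ℕ
    bounded : ∀ (x y : Word g) → accepts auto (conv x y) ≡ true →
              (length y ≤ length x + bound) × (length x ≤ length y + bound)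

Rel : {g : ℕ} → Instruction g → Word g → Word g → Set
Rel J x y = accepts (Instruction.auto J) (conv x y) ≡ true

-- AARMs with input alphabet Σ = Fin s embedded into Γ = Fin g.

record AARM (s : ℕ) : Set where
  field
    g      : ℕ
    ι      : Fin s → Fin g
    ι-inj  : Injective _≡_ _≡_ ι
    A      : List (Instruction g)
    B      : List (Instruction g)

-- Anke (to move, register r) has a winning strategy.  An element is a
-- well-founded strategy tree: Anke picks J ∈ A and x with (r,x) ∈ J,
-- and for every reply of Boris she again has a winning strategy.  If
-- Boris cannot reply the game ends and Anke (last mover) wins; if Anke
-- cannot move she loses; infinite plays are excluded (draws).
data AnkeWins {s : ℕ} (M : AARM s) : Word (AARM.g M) → Set where
  move : ∀ {r} (J : Instruction (AARM.g M)) → J ∈ AARM.A M →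
         (x : Word (AARM.g M)) → Rel J r x →
         (∀ (J′ : Instruction (AARM.g M)) → J′ ∈ AARM.B M →
            ∀ (y : Word (AARM.g M)) → Rel J′ x y → AnkeWins M y) →
         AnkeWins M r

embed : {s : ℕ} (M : AARM s) → List (Fin s) → Word (AARM.g M)
embed M = Data.List.map (AARM.ι M)

Accepts : {s : ℕ} → AARM s → List (Fin s) → Set
Accepts M w = AnkeWins M (embed M w)

-- Turing machines and recursively enumerable languages over Fin s.
-- Tape symbols: nothing = blank, inj₁ a = input letter a, inj₂ k = extra.

data Move : Set where
  left right : Move

record TM (s : ℕ) : Set where
  field
    nStates : ℕ              -- states Fin (suc nStates), start = zero
    nExtra  : ℕ
    δ : Fin (suc nStates) → Maybe (Fin s ⊎ Fin nExtra) →
        Maybe (Fin (suc nStates) × Maybe (Fin s ⊎ Fin nExtra) × Move)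
        -- nothing = halt

module _ {s : ℕ} (T : TM s) where
  open TM T

  Sym : Set
  Sym = Maybe (Fin s ⊎ Fin nExtra)

  -- configuration: state, tape left of head (nearest first), head symbol,
  -- tape right of head; unlisted cells are blank.
  record Config : Set where
    constructor cfg
    field
      state : Fin (suc nStates)
      lft   : List Sym
      hd    : Sym
      rgt   : List Sym

  private
    pop : List Sym → Sym × List Sym
    pop []       = nothing , []
    pop (a ∷ as) = a , as

  step : Config → Maybe Config
  step (cfg q l h r) with δ q h
  ... | nothing = nothing
  ... | just (q′ , b , left)  with pop l
  ...   | (h′ , l′) = just (cfg q′ l′ h′ (b ∷ r))
  step (cfg q l h r) | just (q′ , b , right) with pop r
  ...   | (h′ , r′) = just (cfg q′ (b ∷ l) h′ r′)

  initial : List (Fin s) → Config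
  initial []       = cfg Fin.zero [] nothing []
  initial (a ∷ w)  = cfg Fin.zero [] (just (inj₁ a)) (Data.List.map (λ c → just (inj₁ c)) w)

  run : ℕ → Config → Config
  run zero    c = c
  run (suc n) c with step c
  ... | nothing = c
  ... | just c′ = run n c′

  Halted : Config → Set
  Halted c = step c ≡ nothing

  HaltsOn : List (Fin s) → Set
  HaltsOn w = ∃ λ n → Halted (run n (initial w))

RecEnum : {s : ℕ} → (List (Fin s) → Set) → Set
RecEnum {s} L = ∃ λ (T : TM s) → ∀ w → L w ⇔ HaltsOn T w

{-# OPTIONS --safe #-}
module Submission where

open import Defs
open import Data.Bool using (Bool; true; false; _∧_; _∨_; if_then_else_)
import Data.Bool.Properties as BoolP
open import Data.Empty using (⊥; ⊥-elim)
open import Data.Fin using (Fin; zero; suc; fromℕ)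
import Data.Fin as Fin
import Data.Fin.Properties as FinP
open import Data.List
  using (List; []; _∷_; [_]; _++_; _∷ʳ_; _ʳ++_; length; map; reverse; foldl; replicate; drop; head; null; allFin)
open import Data.List.Membership.Propositional using (_∈_)
open import Data.List.Membership.Propositional.Properties using (∈-map⁺; ∈-allFin)
import Data.List.Properties as ListP
open import Data.List.Relation.Unary.All using (All; []; _∷_)
import Data.List.Relation.Unary.All as All
import Data.List.Relation.Unary.All.Properties as AllP
open import Data.List.Relation.Unary.Any using (here; there)
open import Data.Maybe using (Maybe; just; nothing; is-just; maybe′)
import Data.Maybe as Maybe
open import Data.Nat using (ℕ; zero; suc; _+_; _⊔_; _≤_; _<_; z≤n; s≤s)
open import Data.Nat.Induction using (<-wellFounded)
import Data.Nat.Properties as ℕP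
open import Data.Product using (Σ; ∃; _×_; _,_; proj₁; proj₂; map₁; swap)
open import Data.Sum using (_⊎_; inj₁; inj₂; [_,_]′)
import Data.Sum as Sum
open import Data.Unit using (⊤; tt)
open import Data.Vec using (Vec; []; _∷_; lookup; _[_]≔_)
import Data.Vec as Vec
import Data.Vec.Properties as VecP
open import Function using (id; _∘_; flip)
open import Function.Bundles using (_⇔_; mk⇔; Equivalence)
open import Function.Construct.Composition using (_⇔-∘_)
open import Function.Construct.Symmetry using (⇔-sym)
open import Induction.WellFounded using (Acc; acc)
open import Relation.Binary.Definitions using (DecidableEquality)
open import Relation.Binary.PropositionalEquality hiding ([_])
open import Relation.Nullary using (Dec; yes; no; does)
open import Relation.Nullary.Decidable using (_×-dec_)

-- From a Turing machine to an AARM: the register holds a configuration, Anke always passes and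
-- Boris has to carry out the next step, so that he is stuck exactly when the machine halts.
--
-- From an AARM to a Turing machine: the instructions of each player are merged into one automaton
-- and the choice of a new register content is split into choices of single letters.  A winning
-- strategy of Anke then becomes a finite proof tree of an alternating process.  Processing a list
-- of open tasks, where the letters of a certificate resolve the existential choices and universal
-- choices are replaced by all their instances, empties the list for some certificate iff Anke
-- wins.  A Turing machine that keeps finitely many stacks on the tracks of its tape tries all
-- certificates in turn.

-- Finite types and automata

-- `AnkeWins` branches over all legal replies of Boris, and it can be searched only because
-- boundedness leaves finitely many of them. They are not enumerated as words. The register is
-- followed by a fixed number of pads, and each letter or pad is answered by one letter or an end
-- mark, so every choice ranges over the same finite set. The price is that illegal words can be
-- spelled too; they are settled against the player who wrote them. A certificate is a flat word and
-- need not describe the shape of the proof tree: the task list is served depth first, each task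
-- takes the next letter, and a bad certificate merely fails to empty the list. Checking one
-- certificate is a single pass over it and always ends, so trying all of them in turn needs no
-- dovetailing, although winning itself is not decided.

record Finite (X : Set) : Set where
  field
    size    : ℕ
    to      : X → Fin size
    from    : Fin size → X
    from∘to : ∀ x → from (to x) ≡ x

  to-injective : ∀ {x y} → to x ≡ to y → x ≡ y
  to-injective {x} {y} e = trans (sym (from∘to x)) (trans (cong from e) (from∘to y))

  _≟_ : DecidableEquality X
  x ≟ y with to x FinP.≟ to y
  ... | yes e = yes (to-injective e)
  ... | no ¬e = no (¬e ∘ cong to)

open Finite ⦃ ... ⦄ public

retract : {X Y : Set} → (f : X → Y) (g : Y → X) → (∀ x → g (f x) ≡ x) → Finite Y → Finite X
retract f g gf Y = record
  { size = Y.size ; to = Y.to ∘ f ; from = g ∘ Y.from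
  ; from∘to = λ x → trans (cong g (Y.from∘to (f x))) (gf x) }
  where module Y = Finite Y

instance
  Finite-Fin : ∀ {n} → Finite (Fin n)
  Finite-Fin = record { to = id ; from = id ; from∘to = λ _ → refl }

  Finite-⊤ : Finite ⊤
  Finite-⊤ = record { size = 1 ; to = λ _ → zero ; from = λ _ → tt ; from∘to = λ _ → refl }

  Finite-⊎ : {X Y : Set} ⦃ _ : Finite X ⦄ ⦃ _ : Finite Y ⦄ → Finite (X ⊎ Y)
  Finite-⊎ {X} {Y} ⦃ FX ⦄ ⦃ FY ⦄ = record
    { to = λ z → Fin.join _ _ (Sum.map to to z)
    ; from = λ i → Sum.map from from (Fin.splitAt (size ⦃ FX ⦄) i)
    ; from∘to = λ z → trans (cong (Sum.map from from) (FinP.splitAt-join _ _ (Sum.map to to z))) (inv z) }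
    where
    inv : (z : X ⊎ Y) → Sum.map (from ⦃ FX ⦄) (from ⦃ FY ⦄) (Sum.map to to z) ≡ z
    inv (inj₁ x) = cong inj₁ (from∘to x)
    inv (inj₂ y) = cong inj₂ (from∘to y)

  Finite-× : {X Y : Set} ⦃ _ : Finite X ⦄ ⦃ _ : Finite Y ⦄ → Finite (X × Y)
  Finite-× {X} {Y} ⦃ FX ⦄ ⦃ FY ⦄ = record
    { to = λ p → Fin.combine (to (proj₁ p)) (to (proj₂ p))
    ; from = pair ∘ Fin.remQuot (size ⦃ FY ⦄)
    ; from∘to = inv }
    where
    pair : Fin (size ⦃ FX ⦄) × Fin (size ⦃ FY ⦄) → X × Y
    pair (i , j) = from i , from j
    inv : (p : X × Y) → pair (Fin.remQuot _ (Fin.combine (to (proj₁ p)) (to (proj₂ p)))) ≡ p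
    inv (x , y) = trans (cong pair (FinP.remQuot-combine (to x) (to y)))
                        (cong₂ _,_ (from∘to x) (from∘to y))

  Finite-Maybe : {X : Set} ⦃ _ : Finite X ⦄ → Finite (Maybe X)
  Finite-Maybe {X} = retract f g gf (Finite-⊎ {⊤} {X})
    where
    f : Maybe X → ⊤ ⊎ X
    f nothing  = inj₁ tt
    f (just x) = inj₂ x
    g : ⊤ ⊎ X → Maybe X
    g (inj₁ _) = nothing
    g (inj₂ x) = just x
    gf : ∀ x → g (f x) ≡ x
    gf nothing  = refl
    gf (just _) = refl

  Finite-Bool : Finite Bool
  Finite-Bool = retract f g gf (Finite-Fin {2})
    where
    f : Bool → Fin 2
    f false = zero
    f true  = suc zero
    g : Fin 2 → Bool
    g zero    = false
    g (suc _) = true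
    gf : ∀ x → g (f x) ≡ x
    gf false = refl
    gf true  = refl

  Finite-Vec : {X : Set} {n : ℕ} ⦃ _ : Finite X ⦄ → Finite (Vec X n)
  Finite-Vec {n = zero}  = retract (λ _ → tt) (λ _ → []) (λ { [] → refl }) Finite-⊤
  Finite-Vec {n = suc n} ⦃ FX ⦄ =
    retract (λ { (x ∷ xs) → x , xs }) (λ { (x , xs) → x ∷ xs }) (λ { (_ ∷ _) → refl })
      (Finite-× ⦃ FX ⦄ ⦃ Finite-Vec {n = n} ⦄)

module _ {X : Set} {Q : X → Set} where

  private
    overFin : ∀ n (P : Fin n → Set) → (∀ i → Finite (P i)) → Finite (Σ (Fin n) P)
    overFin zero    P F = retract proj₁ (λ ()) (λ ()) (Finite-Fin {0})
    overFin (suc n) P F = retract split merge inv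
                            (Finite-⊎ ⦃ F zero ⦄ ⦃ overFin n (P ∘ suc) (F ∘ suc) ⦄)
      where
      split : Σ (Fin (suc n)) P → P zero ⊎ Σ (Fin n) (P ∘ suc)
      split (zero  , p) = inj₁ p
      split (suc i , p) = inj₂ (i , p)
      merge : P zero ⊎ Σ (Fin n) (P ∘ suc) → Σ (Fin (suc n)) P
      merge (inj₁ p)       = zero , p
      merge (inj₂ (i , p)) = suc i , p
      inv : ∀ x → merge (split x) ≡ x
      inv (zero  , _) = refl
      inv (suc _ , _) = refl

    along : ∀ {x y} (e : y ≡ x) (q : Q x) → _≡_ {A = Σ X Q} (y , subst Q (sym e) q) (x , q)
    along refl q = refl

  -- The sizes of the fibres vary, so no product formula applies: the base is replaced by the `Fin`
  -- it embeds in, and `overFin` adds up the fibres one index at a time. `along` undoes the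
  -- resulting transport.
  Finite-Σ : Finite X → (∀ x → Finite (Q x)) → Finite (Σ X Q)
  Finite-Σ FX FQ = retract
      (λ { (x , q) → FX.to x , subst Q (sym (FX.from∘to x)) q })
      (λ { (i , q) → FX.from i , q })
      (λ { (x , q) → along (FX.from∘to x) q })
      (overFin _ (Q ∘ FX.from) (FQ ∘ FX.from))
    where module FX = Finite FX

-- State 0 is an extra copy of the start state, since a DFA needs a nonempty `Fin` of states.
module _ {S Σ′ : Set} ⦃ _ : Finite S ⦄ (s₀ : S) (δ : S → Σ′ → S) (final : S → Bool) where

  private
    decode : Fin (suc (size {S})) → S
    decode zero    = s₀
    decode (suc i) = from i

  mkDFA : DFA Σ′
  mkDFA = record
    { nStates = size {S}
    ; start   = zero
    ; δ       = λ i a → suc (to (δ (decode i) a))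
    ; final   = final ∘ decode }

  accepts-mkDFA : ∀ w → accepts mkDFA w ≡ final (foldl δ s₀ w)
  accepts-mkDFA w = cong final (go w zero)
    where
    go : ∀ w i → decode (foldl (DFA.δ mkDFA) i w) ≡ foldl δ (decode i) w
    go []      i = refl
    go (a ∷ w) i = trans (go w (suc (to (δ (decode i) a))))
                         (cong (λ s → foldl δ s w) (from∘to (δ (decode i) a)))

-- Turing machine computations

nth : {C : Set} → C → List C → ℕ → C
nth d []       n       = d
nth d (c ∷ cs) zero    = c
nth d (c ∷ cs) (suc n) = nth d cs n

headOr : {C : Set} → C → List C → C
headOr d []      = d
headOr d (c ∷ _) = c

nth-head : {C : Set} (d : C) (cs : List C) → nth d cs 0 ≡ headOr d cs
nth-head d []      = refl
nth-head d (_ ∷ _) = refl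

nth-tail : {C : Set} (d : C) (cs : List C) (n : ℕ) → nth d (drop 1 cs) n ≡ nth d cs (suc n)
nth-tail d []       n = refl
nth-tail d (_ ∷ cs) n = refl

module _ {s : ℕ} (T : TM s) where

  step-right : ∀ {q h q′ b} l r → TM.δ T q h ≡ just (q′ , b , right) →
               step T (cfg q l h r) ≡ just (cfg q′ (b ∷ l) (headOr nothing r) (drop 1 r))
  step-right l []      e rewrite e = refl
  step-right l (_ ∷ _) e rewrite e = refl

  step-left : ∀ {q h q′ b} l r → TM.δ T q h ≡ just (q′ , b , left) →
              step T (cfg q l h r) ≡ just (cfg q′ (drop 1 l) (headOr nothing l) (b ∷ r))
  step-left []      r e rewrite e = refl
  step-left (_ ∷ _) r e rewrite e = refl

  infixr 5 _◅_

  data Steps : ℕ → Config T → Config T → Set where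
    ε   : ∀ {c} → Steps 0 c c
    _◅_ : ∀ {n c c′ c″} → step T c ≡ just c′ → Steps n c′ c″ → Steps (suc n) c c″

  run-step : ∀ {n c c′} → step T c ≡ just c′ → run T (suc n) c ≡ run T n c′
  run-step e rewrite e = refl

  -- Every configuration before the last one of `Steps` has a successor, so a halting run passes
  -- through all m steps. The exact remainder n′ is what `Rounds.sound` recurs on.
  halts-after : ∀ {m c c′} → Steps m c c′ → ∀ n → Halted T (run T n c) →
                ∃ λ n′ → n ≡ m + n′ × Halted T (run T n′ c′)
  halts-after ε n H = n , refl , H
  halts-after (e ◅ S) zero H with trans (sym e) H
  ... | ()
  halts-after (e ◅ S) (suc n) H with halts-after S n (subst (Halted T) (run-step e) H)
  ... | n′ , refl , H′ = n′ , refl , H′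

  halts-before : ∀ {m c c′} → Steps m c c′ → ∀ n → Halted T (run T n c′) → ∃ λ n′ → Halted T (run T n′ c)
  halts-before ε n H = n , H
  halts-before (e ◅ S) n H with halts-before S n H
  ... | n′ , H′ = suc n′ , subst (Halted T) (sym (run-step e)) H′

-- Simulating a Turing machine by an AARM

guard : {P X : Set} → Dec P → X → Maybe X
guard (yes _) x = just x
guard (no _)  x = nothing

guard-yes : {P X : Set} (d : Dec P) {x : X} → P → guard d x ≡ just x
guard-yes (yes _) p = refl
guard-yes (no ¬p) p = ⊥-elim (¬p p)

module _ {g : ℕ} where

  private
    same : Bool → ConvAlph g → Bool
    same b (x , y) = b ∧ does (x ≟ y)

    reject : ∀ w → foldl same false w ≡ false
    reject []      = refl
    reject (_ ∷ w) = reject w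

    equal : ∀ x y → foldl same true (conv x y) ≡ true → x ≡ y
    equal []      []      e = refl
    equal []      (b ∷ y) e with trans (sym (reject (conv [] y))) e
    ... | ()
    equal (a ∷ x) []      e with trans (sym (reject (conv x []))) e
    ... | ()
    equal (a ∷ x) (b ∷ y) e with _≟_ {X = Maybe (Fin g)} (just a) (just b)
    ... | yes refl = cong (a ∷_) (equal x y e)
    ... | no _ with trans (sym (reject (conv x y))) e
    ... | ()

    refl-accepted : ∀ x → foldl same true (conv x x) ≡ true
    refl-accepted []      = refl
    refl-accepted (a ∷ x) with _≟_ {X = Maybe (Fin g)} (just a) (just a)
    ... | yes _ = refl-accepted x
    ... | no ¬e = ⊥-elim (¬e refl)

    diagonal : DFA (ConvAlph g)
    diagonal = mkDFA true same id

    diagonal-sound : ∀ x y → accepts diagonal (conv x y) ≡ true → x ≡ y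
    diagonal-sound x y e = equal x y (trans (sym (accepts-mkDFA true same id (conv x y))) e)

  identity : Instruction g
  identity = record
    { auto = diagonal ; bound = 0
    ; bounded = λ x y e → subst (λ y → length y ≤ length x + 0 × length x ≤ length y + 0) (diagonal-sound x y e)
                            (ℕP.m≤m+n _ 0 , ℕP.m≤m+n _ 0) }

  identity-sound : ∀ {x y} → Rel identity x y → x ≡ y
  identity-sound {x} {y} = diagonal-sound x y

  identity-refl : ∀ x → Rel identity x x
  identity-refl x = trans (accepts-mkDFA true same id (conv x x)) (refl-accepted x)

-- The register holds a Turing machine configuration as a folded tape: the first letter is the
-- state and the scanned symbol, the n-th later letter pairs the n-th symbols to the left and to
-- the right of the head.  An input letter is read in such a way that the bare input word is
-- a description of the initial configuration.
module Simulation {s : ℕ} (T : TM s) where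

  open TM T

  Tape : Set
  Tape = Sym T

  Q : Set
  Q = Fin (suc nStates)

  Letter : Set
  Letter = Fin s ⊎ (Q × Tape) ⊎ (Tape × Tape)

  pattern inp a    = inj₁ a
  pattern head′ q h = inj₂ (inj₁ (q , h))
  pattern cell p   = inj₂ (inj₂ p)

  γ : ℕ
  γ = size {Letter}

  letter : Fin γ → Letter
  letter = from {Letter}

  blanks : Tape × Tape
  blanks = nothing , nothing

  scanned : Letter → Q × Tape
  scanned (inp a)     = zero , just (inj₁ a)
  scanned (head′ q h) = q , h
  scanned (cell _)    = zero , nothing

  symbols : Letter → Tape × Tape
  symbols (inp a)     = nothing , just (inj₁ a)
  symbols (head′ _ _) = blanks
  symbols (cell p)    = p

  -- The empty input must describe the start on a blank tape, so a missing first letter reads as the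
  -- start state on a blank.
  first : Maybe (Fin γ) → Q × Tape
  first nothing  = zero , nothing
  first (just i) = scanned (letter i)

  look : Maybe (Fin γ) → Tape × Tape
  look nothing  = blanks
  look (just i) = symbols (letter i)

  at : Word γ → ℕ → Tape × Tape
  at []      n       = blanks
  at (i ∷ x) zero    = symbols (letter i)
  at (i ∷ x) (suc n) = at x n

  -- A relation compared cell by cell: because of trailing blanks, neither the word nor the
  -- configuration determines the other.
  record Describes (x : Word γ) (c : Config T) : Set where
    constructor describes
    field
      head-ok  : first (head x) ≡ (Config.state c , Config.hd c)
      cells-ok : ∀ n → at (drop 1 x) n ≡ (nth nothing (Config.lft c) n , nth nothing (Config.rgt c) n)

  -- Orders a pair of symbols as (side that moves towards the head, side that moves away).
  orient : Move → Tape × Tape → Tape × Tape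
  orient left  p = p
  orient right p = swap p

  orient-involutive : ∀ m p → orient m (orient m p) ≡ p
  orient-involutive left  p = refl
  orient-involutive right p = refl

  near far : Move → Tape × Tape → Tape
  near m = proj₁ ∘ orient m
  far  m = proj₂ ∘ orient m

  -- `running m e o` expects e to be the next symbol of the near side of the old tape, and o to be
  -- the next symbol of the far side of the new one.
  State : Set
  State = ⊤ ⊎ (Move × Tape × Tape) ⊎ ⊤

  pattern starting      = inj₁ tt
  pattern running m e o = inj₂ (inj₁ (m , e , o))
  pattern finished      = inj₂ (inj₂ tt)

  instance
    Finite-Move : Finite Move
    Finite-Move = retract (λ { left → false ; right → true }) (λ { false → left ; true → right })
                    (λ { left → refl ; right → refl }) Finite-Bool

  -- The new scanned symbol is taken on trust from the new word. It becomes the expected first near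
  -- symbol of the old tape, and the written symbol b the expected first far symbol of the new one;
  -- both are verified at the next letter.
  begin-with : Maybe (Q × Tape × Move) → Fin γ → Maybe State
  begin-with nothing            j = nothing
  begin-with (just (q′ , b , m)) j =
    let q , h = scanned (letter j) in guard (q ≟ q′) (running m h b)

  shift : State → ConvAlph γ → Maybe State
  shift starting        (x , just j)      = begin-with (let q , h = first x in δ q h) j
  shift (running m e o) (just i , just j) =
    guard ((near m (look (just i)) ≟ e) ×-dec (far m (look (just j)) ≟ o))
      (running m (near m (look (just j))) (far m (look (just i))))
  -- The last new letter has no old counterpart: it receives the outermost far symbol, pushed one
  -- cell outwards, and its near side is blank.
  shift (running m e o) (nothing , just j) =
    guard ((e ≟ nothing) ×-dec (look (just j) ≟ orient m (nothing , o))) finished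
  shift _               _ = nothing

  shift′ : Maybe State → ConvAlph γ → Maybe State
  shift′ nothing  _ = nothing
  shift′ (just q) a = shift q a

  isFinished : Maybe State → Bool
  isFinished (just finished) = true
  isFinished _               = false

  Run : Maybe State → Word γ → Word γ → Set
  Run q x y = isFinished (foldl shift′ q (conv x y)) ≡ true

  stuck : ∀ w → isFinished (foldl shift′ nothing w) ≡ true → ⊥
  stuck (_ ∷ w) e = stuck w e

  guarded : ∀ {P : Set} (d : Dec P) {q w} → isFinished (foldl shift′ (guard d q) w) ≡ true →
            P × isFinished (foldl shift′ (just q) w) ≡ true
  guarded (yes p) e = p , e
  guarded (no _)  {w = w} e = ⊥-elim (stuck w e)

  record Shifted (m : Move) (e o : Tape) (x y : Word γ) : Set where
    field
      len       : length y ≡ suc (length x)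
      near-head : near m (at x 0) ≡ e
      far-head  : far m (at y 0) ≡ o
      near-tail : ∀ n → near m (at y n) ≡ near m (at x (suc n))
      far-tail  : ∀ n → far m (at y (suc n)) ≡ far m (at x n)
  open Shifted

  near-blank : ∀ m → near m blanks ≡ nothing
  near-blank left  = refl
  near-blank right = refl

  run-sound : ∀ m e o x y → Run (just (running m e o)) x y → Shifted m e o x y
  run-sound m e o []      (j ∷ y)       r with guarded ((e ≟ nothing) ×-dec (look (just j) ≟ orient m (nothing , o))) {w = conv [] y} r
  run-sound m e o []      (j ∷ j′ ∷ y)  r | _ , r′ = ⊥-elim (stuck (conv [] y) r′)
  run-sound m e o []      (j ∷ [])      r | (e≡ , p) , _ = record
    { len = refl
    ; near-head = trans (near-blank m) (sym e≡)
    ; far-head = cong proj₂ p′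
    ; near-tail = λ { zero → trans (cong proj₁ p′) (sym (near-blank m)) ; (suc n) → refl }
    ; far-tail = λ n → refl }
    where
    p′ : orient m (symbols (letter j)) ≡ (nothing , o)
    p′ = trans (cong (orient m) p) (orient-involutive m _)
  run-sound m e o (i ∷ x) []      r = ⊥-elim (stuck (conv x []) r)
  run-sound m e o (i ∷ x) (j ∷ y) r
    with guarded ((near m (look (just i)) ≟ e) ×-dec (far m (look (just j)) ≟ o)) {w = conv x y} r
  ... | (n≡ , f≡) , r′ with run-sound m _ _ x y r′
  ... | S = record
    { len = cong suc (len S)
    ; near-head = n≡
    ; far-head = f≡
    ; near-tail = λ { zero → sym (near-head S) ; (suc n) → near-tail S n }
    ; far-tail = λ { zero → far-head S ; (suc n) → far-tail S n } }

  conv-∷ : ∀ x j (y : Word γ) → conv x (j ∷ y) ≡ (head x , just j) ∷ conv (drop 1 x) y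
  conv-∷ []      j y = refl
  conv-∷ (i ∷ x) j y = refl

  shift-automaton : DFA (ConvAlph γ)
  shift-automaton = mkDFA (just starting) shift′ isFinished

  record Stepped (x y : Word γ) : Set where
    field
      {q′}     : Q
      {b}      : Tape
      {m}      : Move
      {h′}     : Tape
      fires    : (let q , h = first (head x) in δ q h) ≡ just (q′ , b , m)
      new-head : first (head y) ≡ (q′ , h′)
      shifted  : Shifted m h′ b (drop 1 x) (drop 1 y)
      nonempty : length y ≡ suc (length (drop 1 y))

  stepped : ∀ x y → accepts shift-automaton (conv x y) ≡ true → Stepped x y
  stepped x y a = go x y (trans (sym (accepts-mkDFA (just starting) shift′ isFinished (conv x y))) a)
    where
    go : ∀ x y → Run (just starting) x y → Stepped x y
    go (i ∷ x) []      r = ⊥-elim (stuck (conv x []) r)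
    go x       (j ∷ y) r rewrite conv-∷ x j y with δ (proj₁ (first (head x))) (proj₂ (first (head x))) in e
    ... | nothing = ⊥-elim (stuck (conv (drop 1 x) y) r)
    ... | just (q′ , b , m) with guarded (proj₁ (scanned (letter j)) ≟ q′) {w = conv (drop 1 x) y} r
    ... | q≡ , r′ = record
      { fires = e ; new-head = cong (_, proj₂ (scanned (letter j))) q≡ ; shifted = run-sound m _ b (drop 1 x) y r′ ; nonempty = refl }

  step-instruction : Instruction γ
  -- The empty word grows by two letters, a head letter and one cell; every other word grows by one.
  step-instruction = record { auto = shift-automaton ; bound = 2 ; bounded = λ x y a → bounds x y (stepped x y a) }
    where
    drop-≤ : ∀ (x : Word γ) → length (drop 1 x) ≤ length x
    drop-≤ []      = z≤n
    drop-≤ (_ ∷ x) = ℕP.n≤1+n _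
    ≤-drop : ∀ (x : Word γ) → length x ≤ suc (length (drop 1 x))
    ≤-drop []      = z≤n
    ≤-drop (_ ∷ x) = ℕP.≤-refl
    bounds : ∀ x y → Stepped x y → length y ≤ length x + 2 × length x ≤ length y + 2
    bounds x y S rewrite Stepped.nonempty S | Shifted.len (Stepped.shifted S) | ℕP.+-comm (length x) 2 =
      s≤s (s≤s (drop-≤ x)) , ℕP.≤-trans (≤-drop x) (ℕP.≤-trans (ℕP.n≤1+n _) (ℕP.m≤m+n _ 2))

  step-sound : ∀ {x y c} → Describes x c → Rel step-instruction x y →
               ∃ λ c′ → step T c ≡ just c′ × Describes y c′
  step-sound {x} {y} {cfg q l h r} (describes hd cs) a with stepped x y a
  ... | record { b = b ; m = left ; fires = e ; new-head = nh ; shifted = S } =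
    _ , step-left T l r (trans (cong (λ (q , h) → δ q h) (sym hd)) e) ,
    describes (trans nh (cong (_ ,_) (trans (sym (near-head S)) (trans (cong proj₁ (cs 0)) (nth-head nothing l)))))
      λ n → cong₂ _,_ (trans (near-tail S n) (trans (cong proj₁ (cs (suc n))) (sym (nth-tail nothing l n)))) (away n)
    where
    away : ∀ n → proj₂ (at (drop 1 y) n) ≡ nth nothing (b ∷ r) n
    away zero    = far-head S
    away (suc n) = trans (far-tail S n) (cong proj₂ (cs n))
  ... | record { b = b ; m = right ; fires = e ; new-head = nh ; shifted = S } =
    _ , step-right T l r (trans (cong (λ (q , h) → δ q h) (sym hd)) e) ,
    describes (trans nh (cong (_ ,_) (trans (sym (near-head S)) (trans (cong proj₂ (cs 0)) (nth-head nothing r)))))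
      λ n → cong₂ _,_ (away n) (trans (near-tail S n) (trans (cong proj₂ (cs (suc n))) (sym (nth-tail nothing r n))))
    where
    away : ∀ n → proj₁ (at (drop 1 y) n) ≡ nth nothing (b ∷ l) n
    away zero    = far-head S
    away (suc n) = trans (far-tail S n) (cong proj₁ (cs n))

  code : Letter → Fin γ
  code = to {Letter}

  letter-code : ∀ a → letter (code a) ≡ a
  letter-code = from∘to {Letter}

  shifted-cells : Move → Tape → Word γ → Word γ
  shifted-cells m o []      = [ code (cell (orient m (nothing , o))) ]
  shifted-cells m o (i ∷ x) =
    code (cell (orient m (near m (at x 0) , o))) ∷ shifted-cells m (far m (symbols (letter i))) x

  run-complete : ∀ m o x → Run (just (running m (near m (at x 0)) o)) x (shifted-cells m o x)
  run-complete m o [] = cong isFinished (guard-yes _ (near-blank m , cong symbols (letter-code (cell (orient m (nothing , o))))))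
  run-complete m o (i ∷ x) =
    trans (cong (λ q → isFinished (foldl shift′ q (conv x (shifted-cells m _ x))))
            (trans (guard-yes _ (refl , cong proj₂ p)) (cong (λ n → just (running m n _)) (cong proj₁ p))))
          (run-complete m _ x)
    where
    p : orient m (symbols (letter (code (cell (orient m (near m (at x 0) , o)))))) ≡ (near m (at x 0) , o)
    p = trans (cong (orient m ∘ symbols) (letter-code (cell (orient m (near m (at x 0) , o))))) (orient-involutive m _)

  step-complete : ∀ x {q′ b m} → (let q , h = first (head x) in δ q h) ≡ just (q′ , b , m) →
                  ∃ (Rel step-instruction x)
  step-complete x {q′} {b} {m} e = y ,
    trans (accepts-mkDFA (just starting) shift′ isFinished (conv x y))
      (trans (cong (isFinished ∘ foldl shift′ (just starting)) (conv-∷ x _ _))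
        (trans (cong (λ q → isFinished (foldl shift′ q (conv (drop 1 x) _))) start) (run-complete m b (drop 1 x))))
    where
    h′ = near m (at (drop 1 x) 0)
    y = code (head′ q′ h′) ∷ shifted-cells m b (drop 1 x)
    start : begin-with (let q , h = first (head x) in δ q h) (code (head′ q′ h′)) ≡ just (running m h′ b)
    start rewrite e | letter-code (head′ q′ h′) = guard-yes (q′ ≟ q′) refl

  -- Passing is always possible, so a play ends only when Boris is stuck, which is a win for Anke.
  -- An endless computation gives an infinite play, a draw, and is not accepted.
  simulator : AARM s
  simulator = record
    { g = γ ; ι = code ∘ inp ; ι-inj = λ e → inp-injective (to-injective {Letter} e)
    ; A = [ identity ] ; B = [ step-instruction ] }
    where
    inp-injective : ∀ {a b} → _≡_ {A = Letter} (inp a) (inp b) → a ≡ b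
    inp-injective refl = refl

  halts⇒wins : ∀ n {x c} → Describes x c → Halted T (run T n c) → AnkeWins simulator x
  halts⇒wins n {x} {c} D H = move identity (here refl) x (identity-refl x) (reply n H)
    where
    reply : ∀ n → Halted T (run T n c) → ∀ J → J ∈ [ step-instruction ] → ∀ y → Rel J x y → AnkeWins simulator y
    reply n H _ (here refl) y r with step-sound D r
    reply zero    H _ (here refl) y r | c′ , e , D′ with trans (sym e) H
    ... | ()
    reply (suc n) H _ (here refl) y r | c′ , e , D′ = halts⇒wins n D′ (subst (Halted T) (run-step T e) H)

  -- Recursion on the strategy tree: if the machine can step, `step-complete` is a legal reply of
  -- Boris, and the subtree at this reply accounts for the rest of the computation.
  wins⇒halts : ∀ {x c} → Describes x c → AnkeWins simulator x → ∃ λ n → Halted T (run T n c)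
  wins⇒halts {x} {c@(cfg q l h r)} D (move _ (here refl) x′ i reply) with identity-sound {x = x} {x′} i
  ... | refl with δ q h in e
  ... | nothing = 0 , halted
    where
    halted : step T c ≡ nothing
    halted rewrite e = refl
  ... | just _ with step-complete x (trans (cong (λ (q , h) → δ q h) (Describes.head-ok D)) e)
  ... | y , a with step-sound D a
  ... | c′ , e′ , D′ with wins⇒halts D′ (reply _ (here refl) y a)
  ... | n , H = suc n , subst (Halted T) (sym (run-step T e′)) H

  input-describes : ∀ w → Describes (embed simulator w) (initial T w)
  input-describes []      = describes refl λ n → refl
  input-describes (a ∷ w) = describes (cong scanned (letter-code (inp a))) (cells w)
    where
    cells : ∀ w n → at (embed simulator w) n ≡ (nothing , nth nothing (map (λ c → just (inj₁ c)) w) n)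
    cells []      n       = refl
    cells (a ∷ w) zero    = cong symbols (letter-code (inp a))
    cells (a ∷ w) (suc n) = cells w n

  halts⇔accepts : ∀ w → HaltsOn T w ⇔ Accepts simulator w
  halts⇔accepts w = mk⇔ (λ (n , H) → halts⇒wins n (input-describes w) H) (wins⇒halts (input-describes w))

-- Programs over stacks

infixl 9 _[_↦_]

_[_↦_] : {C : Set} → (ℕ → C) → ℕ → C → ℕ → C
(f [ zero  ↦ c ]) zero    = c
(f [ zero  ↦ c ]) (suc m) = f (suc m)
(f [ suc n ↦ c ]) zero    = f zero
(f [ suc n ↦ c ]) (suc m) = ((f ∘ suc) [ n ↦ c ]) m

↦-same : {C : Set} (f : ℕ → C) (n : ℕ) {c : C} → (f [ n ↦ c ]) n ≡ c
↦-same f zero    = refl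
↦-same f (suc n) = ↦-same (f ∘ suc) n

↦-other : {C : Set} (f : ℕ → C) (n : ℕ) {c : C} {m : ℕ} → m ≢ n → (f [ n ↦ c ]) m ≡ f m
↦-other f zero    {m = zero}  m≢n = ⊥-elim (m≢n refl)
↦-other f zero    {m = suc m} m≢n = refl
↦-other f (suc n) {m = zero}  m≢n = refl
↦-other f (suc n) {m = suc m} m≢n = ↦-other (f ∘ suc) n (m≢n ∘ cong suc)

↦-stutter : {C : Set} (f : ℕ → C) (n : ℕ) {c : C} → f n ≡ c → ∀ m → (f [ n ↦ c ]) m ≡ f m
↦-stutter f n e m with m ℕP.≟ n
... | yes refl = trans (↦-same f n) (sym e)
... | no  m≢n  = ↦-other f n m≢n

-- Heights are counted from the bottom so that a push or a pop moves no other element and changes a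
-- single tape cell.
fromBottom : {A : Set} → List A → ℕ → Maybe A
fromBottom []       n = nothing
fromBottom (a ∷ xs) n with n ℕP.≟ length xs
... | yes _ = just a
... | no  _ = fromBottom xs n

module _ {A : Set} where

  fromBottom-top : ∀ (a : A) xs → fromBottom (a ∷ xs) (length xs) ≡ just a
  fromBottom-top a xs with length xs ℕP.≟ length xs
  ... | yes _ = refl
  ... | no ¬e = ⊥-elim (¬e refl)

  fromBottom-below : ∀ (a : A) xs {n} → n ≢ length xs → fromBottom (a ∷ xs) n ≡ fromBottom xs n
  fromBottom-below a xs {n} ne with n ℕP.≟ length xs
  ... | yes e = ⊥-elim (ne e)
  ... | no  _ = refl

  fromBottom-≥ : ∀ (xs : List A) {n} → length xs ≤ n → fromBottom xs n ≡ nothing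
  fromBottom-≥ []       _  = refl
  fromBottom-≥ (a ∷ xs) le =
    trans (fromBottom-below a xs (λ e → ℕP.<-irrefl (sym e) le)) (fromBottom-≥ xs (ℕP.<⇒≤ le))

  fromBottom-< : ∀ (xs : List A) {n} → n < length xs → ∃ λ a → fromBottom xs n ≡ just a
  fromBottom-< (a ∷ xs) {n} lt with n ℕP.≟ length xs
  ... | yes _ = a , refl
  ... | no ne = fromBottom-< xs (ℕP.≤∧≢⇒< (ℕP.≤-pred lt) ne)

module StackMachine (k : ℕ) (A : Set) ⦃ FA : Finite A ⦄ where

  Store : Set
  Store = Vec (List A) k

  infixl 1 _>>=_ _>>_
  infix 0 _⊢_⇒_∣_

  -- A deep embedding, so that the control points of the Turing machine can be computed from the
  -- syntax. Intermediate results are finite because they become part of the machine state.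
  data Prog : Set → Set₁ where
    ret   : {X : Set} → X → Prog X
    push  : Fin k → A → Prog ⊤
    pop   : Fin k → Prog (Maybe A)
    _>>=_ : {X Y : Set} ⦃ _ : Finite X ⦄ → Prog X → (X → Prog Y) → Prog Y
    iter  : {X Y : Set} ⦃ _ : Finite X ⦄ → (X → Prog (X ⊎ Y)) → X → Prog Y

  _>>_ : {X Y : Set} ⦃ _ : Finite X ⦄ → Prog X → Prog Y → Prog Y
  p >> q = p >>= λ _ → q

  data _⊢_⇒_∣_ : {X : Set} → Prog X → Store → X → Store → Set₁ where
    ret    : ∀ {X} {x : X} {s} → ret x ⊢ s ⇒ x ∣ s
    push   : ∀ {i a s} → push i a ⊢ s ⇒ tt ∣ s [ i ]≔ (a ∷ lookup s i)
    pop-[] : ∀ {i s} → lookup s i ≡ [] → pop i ⊢ s ⇒ nothing ∣ s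
    pop-∷  : ∀ {i s a xs} → lookup s i ≡ a ∷ xs → pop i ⊢ s ⇒ just a ∣ s [ i ]≔ xs
    _⟫_    : ∀ {X Y} ⦃ _ : Finite X ⦄ {p : Prog X} {f : X → Prog Y} {s x s′ y s″} →
             p ⊢ s ⇒ x ∣ s′ → f x ⊢ s′ ⇒ y ∣ s″ → (p >>= f) ⊢ s ⇒ y ∣ s″
    again  : ∀ {X Y} ⦃ _ : Finite X ⦄ {f : X → Prog (X ⊎ Y)} {s x x′ s′ y s″} →
             f x ⊢ s ⇒ inj₁ x′ ∣ s′ → iter f x′ ⊢ s′ ⇒ y ∣ s″ → iter f x ⊢ s ⇒ y ∣ s″
    leave  : ∀ {X Y} ⦃ _ : Finite X ⦄ {f : X → Prog (X ⊎ Y)} {s x y s′} →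
             f x ⊢ s ⇒ inj₂ y ∣ s′ → iter f x ⊢ s ⇒ y ∣ s′

  infixl 5 _⟫_

  -- Tape layout: cell 0 is the home marker `nothing`; cell n + 1 holds, for every stack, its
  -- n-th element from the bottom.  Between two instructions the head is on cell 1.
  Cell : Set
  Cell = Maybe (Vec (Maybe A) k)

  Tape : Set
  Tape = ℕ → Cell

  -- The control points. Those of `iter f x` do not depend on x, so all rounds of a loop share them.
  Pos : {X : Set} → Prog X → Set
  Pos (ret x)           = ⊤
  Pos (push i a)        = ⊤ ⊎ ⊤
  Pos (pop i)           = ⊤ ⊎ ⊤ ⊎ Maybe A
  Pos (_>>=_ {X} p f)   = Pos p ⊎ Σ X (λ x → Pos (f x))
  Pos (iter {X} f x)    = Σ X (λ x → Pos (f x))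

  finitePos : {X : Set} (p : Prog X) → Finite (Pos p)
  finitePos (ret x)              = Finite-⊤
  finitePos (push i a)           = Finite-⊎
  finitePos (pop i)              = Finite-⊎
  finitePos (_>>=_ ⦃ FX ⦄ p f)   =
    Finite-⊎ ⦃ finitePos p ⦄ ⦃ Finite-Σ FX (λ x → finitePos (f x)) ⦄
  finitePos (iter ⦃ FX ⦄ f x)    = Finite-Σ FX (λ x → finitePos (f x))

  entry : {X : Set} (p : Prog X) → Pos p
  entry (ret x)    = tt
  entry (push i a) = inj₁ tt
  entry (pop i)    = inj₁ tt
  entry (p >>= f)  = inj₁ (entry p)
  entry (iter f x) = x , entry (f x)

  -- The home marker ends the walk to the left, and the exit moves right onto cell 1, where the next
  -- instruction expects the head.
  homeward : {P X : Set} → P → X → Cell → (P ⊎ X) × Cell × Move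
  homeward q x nothing  = inj₂ x , nothing , right
  homeward q x (just v) = inj₁ q , just v , left

  tick : {X : Set} (p : Prog X) → Pos p → Cell → (Pos p ⊎ X) × Cell × Move
  -- Even `ret` walks home and back, since an exit is possible only from cell 0.
  tick (ret x) _ c = homeward tt x c
  tick (push i a) (inj₂ _) c = homeward (inj₂ tt) tt c
  tick (push i a) (inj₁ _) nothing = inj₁ (inj₁ tt) , nothing , right
  tick (push i a) (inj₁ _) (just v) with lookup v i
  ... | just _  = inj₁ (inj₁ tt) , just v , right
  ... | nothing = inj₁ (inj₂ tt) , just (v [ i ]≔ just a) , left
  tick (pop i) (inj₁ _) nothing = inj₁ (inj₁ tt) , nothing , right
  tick (pop i) (inj₁ _) (just v) with lookup v i
  ... | just _  = inj₁ (inj₁ tt) , just v , right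
  ... | nothing = inj₁ (inj₂ (inj₁ tt)) , just v , left
  -- The cell below the first free one is the home marker exactly when the stack is empty.
  tick (pop i) (inj₂ (inj₁ _)) nothing  = inj₂ nothing , nothing , right
  tick (pop i) (inj₂ (inj₁ _)) (just v) = inj₁ (inj₂ (inj₂ (lookup v i))) , just (v [ i ]≔ nothing) , left
  tick (pop i) (inj₂ (inj₂ m)) c = homeward (inj₂ (inj₂ m)) m c
  tick (p >>= f) (inj₁ q) c =
    map₁ [ inj₁ ∘ inj₁ , (λ x → inj₁ (inj₂ (x , entry (f x)))) ]′ (tick p q c)
  tick (p >>= f) (inj₂ (x , q)) c =
    map₁ [ inj₁ ∘ inj₂ ∘ (x ,_) , inj₂ ]′ (tick (f x) q c)
  tick (iter f _) (x , q) c =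
    map₁ [ inj₁ ∘ (x ,_) , [ (λ x′ → inj₁ (x′ , entry (f x′))) , inj₂ ]′ ]′ (tick (f x) q c)

  data Exec {X : Set} (p : Prog X) : Pos p → ℕ → Tape → X → Tape → Set where
    exit : ∀ {q f x b} → tick p q (f 0) ≡ (inj₂ x , b , right) → Exec p q 0 f x (f [ 0 ↦ b ])
    goR  : ∀ {q q′ n f x f′ b} → tick p q (f n) ≡ (inj₁ q′ , b , right) →
           Exec p q′ (suc n) (f [ n ↦ b ]) x f′ → Exec p q n f x f′
    goL  : ∀ {q q′ n f x f′ b} → tick p q (f (suc n)) ≡ (inj₁ q′ , b , left) →
           Exec p q′ n (f [ suc n ↦ b ]) x f′ → Exec p q (suc n) f x f′

  -- A part p inside a program P: `h` embeds the control points, and `j` tells whether an exit of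
  -- the part becomes a further point or an exit of P. Both halves of `_>>=_` and the bodies of
  -- loops are instances.
  module _ {X Y : Set} {p : Prog X} {P : Prog Y} (h : Pos p → Pos P) (j : X → Pos P ⊎ Y)
           (sim : ∀ q c → tick P (h q) c ≡ map₁ [ inj₁ ∘ h , j ]′ (tick p q c)) where

    private
      lift : ∀ {q c t} → tick p q c ≡ t → tick P (h q) c ≡ map₁ [ inj₁ ∘ h , j ]′ t
      lift {q} {c} e = trans (sim q c) (cong (map₁ [ inj₁ ∘ h , j ]′) e)

      at-exit : ∀ {x r} → j x ≡ r → ∀ {b : Cell} {m : Move} →
                map₁ [ inj₁ ∘ h , j ]′ (inj₂ x , b , m) ≡ (r , b , m)
      at-exit refl = refl

    exec-seq : ∀ {q n f x f′ Q y f″} → j x ≡ inj₁ Q →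
               Exec p q n f x f′ → Exec P Q 1 f′ y f″ → Exec P (h q) n f y f″
    exec-seq jx (exit e)  E = goR (trans (lift e) (at-exit jx)) E
    exec-seq jx (goR e D) E = goR (lift e) (exec-seq jx D E)
    exec-seq jx (goL e D) E = goL (lift e) (exec-seq jx D E)

    exec-end : ∀ {q n f x f′ y} → j x ≡ inj₂ y → Exec p q n f x f′ → Exec P (h q) n f y f′
    exec-end jx (exit e)  = exit (trans (lift e) (at-exit jx))
    exec-end jx (goR e D) = goR (lift e) (exec-end jx D)
    exec-end jx (goL e D) = goL (lift e) (exec-end jx D)

  record Represents (s : Store) (f : Tape) : Set where
    field
      home  : f 0 ≡ nothing
      cells : ∀ n → ∃ λ v → f (suc n) ≡ just v × (∀ i → lookup v i ≡ fromBottom (lookup s i) n)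

  open Represents

  represents-≗ : ∀ {s f g} → (∀ n → g n ≡ f n) → Represents s f → Represents s g
  represents-≗ e R .home = trans (e 0) (home R)
  represents-≗ e R .cells n with cells R n
  ... | v , eq , l = v , trans (e (suc n)) eq , l

  represents-stutter : ∀ {s f n c} → f n ≡ c → Represents s f → Represents s (f [ n ↦ c ])
  represents-stutter {f = f} {n} e = represents-≗ (↦-stutter f n e)

  -- Serves push and pop alike: the new stack differs from the old one at height n at most.
  represents-write : ∀ {s f} i ys n {o v} → fromBottom ys n ≡ o →
    (∀ {m} → m ≢ n → fromBottom ys m ≡ fromBottom (lookup s i) m) →
    Represents s f → f (suc n) ≡ just v →
    Represents (s [ i ]≔ ys) (f [ suc n ↦ just (v [ i ]≔ o) ])
  represents-write i ys n eo same R ev .home = home R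
  represents-write {s} {f} i ys n {o} {v} eo same R ev .cells m with cells R m | m ℕP.≟ n
  ... | u , eu , l | no m≢n = u , trans (↦-other (f ∘ suc) n m≢n) eu , track
    where
    track : ∀ j → lookup u j ≡ fromBottom (lookup (s [ i ]≔ ys) j) m
    track j with j FinP.≟ i
    ... | yes refl rewrite VecP.lookup∘update i s ys = trans (l i) (sym (same m≢n))
    ... | no j≢i rewrite VecP.lookup∘update′ j≢i s ys = l j
  ... | u , eu , l | yes refl = v [ i ]≔ o , ↦-same (f ∘ suc) n , track
    where
    u≡v : just u ≡ just v
    u≡v = trans (sym eu) ev
    track : ∀ j → lookup (v [ i ]≔ o) j ≡ fromBottom (lookup (s [ i ]≔ ys) j) m
    track j with j FinP.≟ i
    ... | yes refl rewrite VecP.lookup∘update i s ys = trans (VecP.lookup∘update i v o) (sym eo)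
    ... | no j≢i rewrite VecP.lookup∘update′ j≢i s ys with u≡v
    ... | refl = trans (VecP.lookup∘update′ j≢i v o) (l j)

  Reaches : {X : Set} (p : Prog X) → Pos p → ℕ → Tape → X → Store → Set
  Reaches p q n f x s = ∃ λ f′ → Exec p q n f x f′ × Represents s f′

  module _ {X : Set} {p : Prog X} where

    goR′ : ∀ {q q′ n f x s b} → tick p q (f n) ≡ (inj₁ q′ , b , right) →
           Reaches p q′ (suc n) (f [ n ↦ b ]) x s → Reaches p q n f x s
    goR′ e (f′ , E , R) = f′ , goR e E , R

    goL′ : ∀ {q q′ n f x s b} → tick p q (f (suc n)) ≡ (inj₁ q′ , b , left) →
           Reaches p q′ n (f [ suc n ↦ b ]) x s → Reaches p q (suc n) f x s
    goL′ e (f′ , E , R) = f′ , goL e E , R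

    return-home : ∀ {q x} → (∀ c → tick p q c ≡ homeward q x c) →
                  ∀ {s} n {f} → Represents s f → Reaches p q n f x s
    return-home {q} spec zero {f} R =
      _ , exit (trans (cong (tick p q) (home R)) (spec nothing)) , represents-stutter (home R) R
    return-home {q} spec (suc n) {f} R with cells R n
    ... | v , e , _ = goL′ (trans (cong (tick p q) e) (spec (just v)))
                           (return-home spec n (represents-stutter e R))

    -- Induction on the distance d to the first free cell of track i; below it the track is
    -- occupied, so `spec` keeps the head moving.
    seek-top : ∀ {q i s x s′} →
      (∀ {v a} → lookup v i ≡ just a → tick p q (just v) ≡ (inj₁ q , just v , right)) →
      (∀ {f} → Represents s f → Reaches p q (suc (length (lookup s i))) f x s′) →
      ∀ d n {f} → n + d ≡ length (lookup s i) → Represents s f → Reaches p q (suc n) f x s′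
    seek-top spec top zero n e R rewrite ℕP.+-identityʳ n | e = top R
    seek-top {q} {i} {s} spec top (suc d) n e R
      with cells R n | fromBottom-< (lookup s i) (subst (suc n ≤_) e (ℕP.m<m+n n (s≤s z≤n)))
    ... | v , ev , l | a , ea =
      goR′ (trans (cong (tick p q) ev) (spec (trans (l i) ea)))
           (seek-top spec top d (suc n) (trans (sym (ℕP.+-suc n d)) e) (represents-stutter ev R))

  compile-push : ∀ i a {s f} → Represents s f →
    Reaches (push i a) (inj₁ tt) 1 f tt (s [ i ]≔ (a ∷ lookup s i))
  compile-push i a {s} = seek-top {s = s} skip top (length xs) 0 refl
    where
    xs = lookup s i
    skip : ∀ {v b} → lookup v i ≡ just b →
           tick (push i a) (inj₁ tt) (just v) ≡ (inj₁ (inj₁ tt) , just v , right)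
    skip e rewrite e = refl
    put : ∀ {v} → lookup v i ≡ nothing →
          tick (push i a) (inj₁ tt) (just v) ≡ (inj₁ (inj₂ tt) , just (v [ i ]≔ just a) , left)
    put e rewrite e = refl
    top : ∀ {f} → Represents s f → Reaches (push i a) (inj₁ tt) (suc (length xs)) f tt (s [ i ]≔ (a ∷ xs))
    top {f} R with cells R (length xs)
    ... | v , ev , l =
      goL′ (trans (cong (tick (push i a) (inj₁ tt)) ev) (put (trans (l i) (fromBottom-≥ xs ℕP.≤-refl))))
           (return-home (λ _ → refl) (length xs)
             (represents-write i (a ∷ xs) (length xs) (fromBottom-top a xs) (fromBottom-below a xs) R ev))

  module _ (i : Fin k) (s : Store) where

    private
      skip : ∀ {v b} → lookup v i ≡ just b →
             tick (pop i) (inj₁ tt) (just v) ≡ (inj₁ (inj₁ tt) , just v , right)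
      skip e rewrite e = refl

      turn : ∀ {v} → lookup v i ≡ nothing →
             tick (pop i) (inj₁ tt) (just v) ≡ (inj₁ (inj₂ (inj₁ tt)) , just v , left)
      turn e rewrite e = refl

      top : ∀ {x s′} →
        (∀ {f} → Represents s f → Reaches (pop i) (inj₂ (inj₁ tt)) (length (lookup s i)) f x s′) →
        ∀ {f} → Represents s f → Reaches (pop i) (inj₁ tt) (suc (length (lookup s i))) f x s′
      top next {f} R with cells R (length (lookup s i))
      ... | v , ev , l =
        goL′ (trans (cong (tick (pop i) (inj₁ tt)) ev)
                    (turn (trans (l i) (fromBottom-≥ (lookup s i) ℕP.≤-refl))))
             (next (represents-stutter ev R))

    compile-pop-[] : ∀ {f} → lookup s i ≡ [] → Represents s f → Reaches (pop i) (inj₁ tt) 1 f nothing s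
    compile-pop-[] {f} e =
        seek-top {s = s} skip (top below) (length (lookup s i)) 0 refl
      where
      below : ∀ {f} → Represents s f →
              Reaches (pop i) (inj₂ (inj₁ tt)) (length (lookup s i)) f nothing s
      below R rewrite e =
        _ , exit (cong (tick (pop i) (inj₂ (inj₁ tt))) (home R)) , represents-stutter (home R) R

    compile-pop-∷ : ∀ {f a xs} → lookup s i ≡ a ∷ xs → Represents s f →
                    Reaches (pop i) (inj₁ tt) 1 f (just a) (s [ i ]≔ xs)
    compile-pop-∷ {f} {a} {xs} e =
        seek-top {s = s} skip (top below) (length (lookup s i)) 0 refl
      where
      below : ∀ {f} → Represents s f →
              Reaches (pop i) (inj₂ (inj₁ tt)) (length (lookup s i)) f (just a) (s [ i ]≔ xs)
      below {f} R rewrite cong length e with cells R (length xs)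
      ... | v , ev , l =
        goL′ (trans (cong (tick (pop i) (inj₂ (inj₁ tt))) ev)
                    (cong (λ m → inj₁ (inj₂ (inj₂ m)) , just (v [ i ]≔ nothing) , left)
                      (trans (l i) (trans (cong (λ ys → fromBottom ys (length xs)) e) (fromBottom-top a xs)))))
             (return-home (λ _ → refl) (length xs)
               (represents-write i xs (length xs) (fromBottom-≥ xs ℕP.≤-refl)
                 (λ m≢ → trans (sym (fromBottom-below a xs m≢))
                               (cong (λ ys → fromBottom ys _) (sym e))) R ev))

  compile : ∀ {X} {p : Prog X} {s x s′} → p ⊢ s ⇒ x ∣ s′ →
            ∀ {f} → Represents s f → Reaches p (entry p) 1 f x s′
  compile ret R = return-home (λ _ → refl) 1 R
  compile push R = compile-push _ _ R
  compile (pop-[] e) R = compile-pop-[] _ _ e R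
  compile (pop-∷ e) R = compile-pop-∷ _ _ e R
  compile (D ⟫ D′) R with compile D R
  ... | f′ , E , R′ with compile D′ R′
  ... | f″ , E′ , R″ =
    f″ , exec-seq inj₁ _ (λ _ _ → refl) refl E
           (exec-end (λ q → inj₂ (_ , q)) inj₂ (λ _ _ → refl) refl E′) , R″
  compile {p = iter g x} (again D D′) R with compile D R
  ... | f′ , E , R′ with compile D′ R′
  ... | f″ , E′ , R″ =
    f″ , exec-seq {P = iter g x} (_ ,_) _ (λ _ _ → refl) refl E (reindex E′) , R″
    where
    -- `Exec` is indexed by the program and thereby by the start value of the loop, which `Pos` and
    -- `tick` ignore.
    reindex : ∀ {x′ q n f y f′} → Exec (iter g x′) q n f y f′ → Exec (iter g x) q n f y f′
    reindex (exit e)  = exit e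
    reindex (goR e E) = goR e (reindex E)
    reindex (goL e E) = goL e (reindex E)
  compile {p = iter g x} (leave D) R with compile D R
  ... | f′ , E , R′ = f′ , exec-end {P = iter g x} (_ ,_) _ (λ _ _ → refl) refl E , R′

-- Compilation to Turing machines

module Search {s : ℕ} (k : ℕ) (A : Set) ⦃ FA : Finite A ⦄ (letter : Fin s → A) where

  open StackMachine (suc k) A
  open Represents

  module _ (body : Prog Bool) where

    private
      instance
        finBody = finitePos body

    Q : Set
    Q = ⊤ ⊎ Pos body ⊎ ⊤

    pattern mark = inj₁ tt
    pattern at q = inj₂ (inj₁ q)
    pattern done = inj₂ (inj₂ tt)

    Letter : Set
    Letter = Maybe (Fin s ⊎ Fin (size {Cell}))

    -- An input letter is read as a cell that holds it on stack 0, so that the untouched input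
    -- already is a stack.
    read : Letter → Cell
    read nothing         = just (Vec.replicate _ nothing)
    read (just (inj₁ a)) = just (Vec.replicate _ nothing [ zero ]≔ just (letter a))
    read (just (inj₂ e)) = from e

    write : Cell → Letter
    write c = just (inj₂ (to c))

    next : Pos body ⊎ Bool → Q
    next (inj₁ q)     = at q
    next (inj₂ true)  = done
    next (inj₂ false) = at (entry body)

    code : Q → Fin (suc (size {Q}))
    code q = suc (to q)

    transition : (Pos body ⊎ Bool) × Cell × Move → Maybe (Fin (suc (size {Q})) × Letter × Move)
    transition (q , c , m) = just (code (next q) , write c , m)

    control : Q → Letter → Maybe (Fin (suc (size {Q})) × Letter × Move)
    control mark   _ = just (code (at (entry body)) , write nothing , right)
    control (at q) a = transition (tick body q (read a))
    control done   _ = nothing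

    machine : TM s
    machine = record { nStates = size {Q} ; nExtra = size {Cell} ; δ = table }
      where
      table : Fin (suc (size {Q})) → Letter → Maybe (Fin (suc (size {Q})) × Letter × Move)
      -- The head first steps to the blank left of the input, where `mark` writes the home marker
      -- and turns back.
      table zero    a = just (code mark , a , left)
      table (suc i) a = control (from i) a

    -- Exactly the cells below n are listed. `Exec` has no left move from cell 0, so no blank ever
    -- has to be supplied on this side.
    LeftOf : List Letter → ℕ → Tape → Set
    LeftOf []      zero    f = ⊤
    LeftOf []      (suc n) f = ⊥
    LeftOf (b ∷ l) zero    f = ⊥
    LeftOf (b ∷ l) (suc n) f = read b ≡ f n × LeftOf l n f

    LeftOf-≗ : ∀ l n {f g} → (∀ {m} → m < n → g m ≡ f m) → LeftOf l n f → LeftOf l n g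
    LeftOf-≗ []      zero    e L       = tt
    LeftOf-≗ (b ∷ l) (suc n) e (h , L) =
      trans h (sym (e ℕP.≤-refl)) , LeftOf-≗ l n (λ lt → e (ℕP.m<n⇒m<1+n lt)) L

    record Shows (q : Q) (n : ℕ) (f : Tape) (c : Config machine) : Set where
      constructor shows
      field
        state-ok : Config.state c ≡ code q
        left-ok  : LeftOf (Config.lft c) n f
        head-ok  : read (Config.hd c) ≡ f n
        right-ok : ∀ m → read (nth nothing (Config.rgt c) m) ≡ f (suc n + m)

    read-write : ∀ c → read (write c) ≡ c
    read-write = from∘to

    control-code : ∀ q a → TM.δ machine (code q) a ≡ control q a
    control-code q a = cong (λ q → control q a) (from∘to q)

    δ-tick : ∀ {q h c r} → read h ≡ c → tick body q c ≡ r → TM.δ machine (code (at q)) h ≡ transition r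
    δ-tick {q} {h} refl refl = control-code (at q) h

    move-right : ∀ {q n f c r b} → Shows (at q) n f c → tick body q (f n) ≡ (r , b , right) →
                 ∃ λ c′ → step machine c ≡ just c′ × Shows (next r) (suc n) (f [ n ↦ b ]) c′
    move-right {q} {n} {f} {cfg _ l h r} {b = b} (shows refl L H R) t =
      _ , step-right machine {q = code (at q)} {h = h} l r (δ-tick {q} {h} H t) ,
      shows refl
        (trans (read-write _) (sym (↦-same f n)) ,
         LeftOf-≗ l n (λ lt → ↦-other f n (ℕP.<⇒≢ lt)) L)
        (trans (cong read (sym (nth-head nothing r)))
          (trans (R 0) (trans (cong f (ℕP.+-identityʳ _)) (sym (↦-other f n ℕP.1+n≢n)))))
        (λ m → trans (cong read (nth-tail nothing r m))
          (trans (R (suc m)) (trans (cong f (ℕP.+-suc (suc n) m))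
            (sym (↦-other f n (λ e → ℕP.<-irrefl (sym e) (ℕP.m<n⇒m<1+n (s≤s (ℕP.m≤m+n n m)))))))))

    move-left : ∀ {q n f c r b} → Shows (at q) (suc n) f c → tick body q (f (suc n)) ≡ (r , b , left) →
                ∃ λ c′ → step machine c ≡ just c′ × Shows (next r) n (f [ suc n ↦ b ]) c′
    move-left {q} {n} {f} {cfg _ (a ∷ l) h r} {b = b} (shows refl (La , L) H R) t =
      _ , step-left machine {q = code (at q)} {h = h} (a ∷ l) r (δ-tick {q} {h} H t) ,
      shows refl
        (LeftOf-≗ l n (λ lt → ↦-other f (suc n) (ℕP.<⇒≢ (ℕP.m<n⇒m<1+n lt))) L)
        (trans La (sym (↦-other f (suc n) (ℕP.<⇒≢ ℕP.≤-refl))))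
        right′
      where
      right′ : ∀ m → read (nth nothing (write b ∷ r) m) ≡ (f [ suc n ↦ b ]) (suc n + m)
      right′ zero    rewrite ℕP.+-identityʳ n = trans (read-write _) (sym (↦-same f (suc n)))
      right′ (suc m) = trans (R m) (trans (cong f (sym (ℕP.+-suc (suc n) m)))
        (sym (↦-other f (suc n) (λ e → ℕP.<-irrefl (sym e) (s≤s (ℕP.m<m+n n (s≤s z≤n)))))))

    -- At least one step: this makes a halting computation pass through finitely many rounds.
    simulate : ∀ {q n f x f′ c} → Exec body q n f x f′ → Shows (at q) n f c →
               ∃ λ m → ∃ λ c′ → Steps machine (suc m) c c′ × Shows (next (inj₂ x)) 1 f′ c′
    simulate (exit e) V with move-right V e
    ... | c′ , e′ , V′ = 0 , c′ , e′ ◅ ε , V′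
    simulate (goR e E) V with move-right V e
    ... | c′ , e′ , V′ with simulate E V′
    ... | m , c″ , S , V″ = suc m , c″ , e′ ◅ S , V″
    simulate (goL e E) V with move-left V e
    ... | c′ , e′ , V′ with simulate E V′
    ... | m , c″ , S , V″ = suc m , c″ , e′ ◅ S , V″

    Ready : Store → Config machine → Set
    Ready σ c = ∃ λ f → Represents σ f × Shows (at (entry body)) 1 f c

    module Rounds (σ : ℕ → Store) (found : ℕ → Bool)
      (round : ∀ i → ∃ λ σ′ → (body ⊢ σ i ⇒ found i ∣ σ′) × (found i ≡ false → σ′ ≡ σ (suc i))) where

      next-round : ∀ i {c} → Ready (σ i) c →
        ∃ λ m → ∃ λ c′ → Steps machine (suc m) c c′ ×
        ((found i ≡ true × Halted machine c′) ⊎ (found i ≡ false × Ready (σ (suc i)) c′))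
      next-round i (f , R , V) with round i
      ... | σ′ , D , cont with compile D R
      ... | f′ , E , R′ with simulate E V
      ... | m , c′ , S , V′ with found i
      ... | true  = m , c′ , S , inj₁ (refl , halted V′)
        where
        halted : ∀ {c n f} → Shows done n f c → Halted machine c
        halted {cfg _ l h r} (shows refl _ _ _) rewrite control-code done h = refl
      ... | false = m , c′ , S , inj₂ (refl , f′ , subst (λ σ → Represents σ f′) (cont refl) R′ , V′)

      sound : ∀ n → Acc _<_ n → ∀ i {c} → Ready (σ i) c → Halted machine (run machine n c) →
              ∃ λ j → found j ≡ true
      sound n (acc rec) i Rd H with next-round i Rd
      ... | m , c′ , S , inj₁ (e , _) = i , e
      ... | m , c′ , S , inj₂ (_ , Rd′) with halts-after machine S n H
      ... | n′ , refl , H′ = sound n′ (rec (s≤s (ℕP.m≤n+m n′ m))) (suc i) Rd′ H′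

      -- A round before d + i may already succeed; the machine then halts earlier, which is all that
      -- is claimed.
      complete : ∀ d i {c} → Ready (σ i) c → found (d + i) ≡ true →
                 ∃ λ n → Halted machine (run machine n c)
      complete d i Rd e with next-round i Rd
      complete d i Rd e | m , c′ , S , inj₁ (_ , H) = halts-before machine S 0 H
      complete zero i Rd e | m , c′ , S , inj₂ (e′ , Rd′) with trans (sym e) e′
      ... | ()
      complete (suc d) i Rd e | m , c′ , S , inj₂ (_ , Rd′)
        with complete d (suc i) Rd′ (trans (cong found (ℕP.+-suc d i)) e)
      ... | n , H = halts-before machine S n H

    -- Cell 1 is the bottom of every stack, so the first input letter lies lowest.
    initialStore : List (Fin s) → Store
    initialStore w = reverse (map letter w) ∷ Vec.replicate _ []

    private
      input : List (Fin s) → List Letter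
      input = map (λ a → just (inj₁ a))

      startTape : List (Fin s) → Tape
      startTape w zero    = nothing
      startTape w (suc n) = read (nth nothing (input w) n)

      length-∷ʳ : ∀ (xs : List A) a → length (xs ∷ʳ a) ≡ suc (length xs)
      length-∷ʳ xs a = trans (ListP.length-++ xs) (ℕP.+-comm (length xs) 1)

      fromBottom-∷ʳ : ∀ (xs : List A) a n → fromBottom (xs ∷ʳ a) (suc n) ≡ fromBottom xs n
      fromBottom-∷ʳ []       a n = refl
      fromBottom-∷ʳ (x ∷ xs) a n with n ℕP.≟ length xs
      ... | yes refl = trans (cong (fromBottom (x ∷ xs ∷ʳ a)) (sym (length-∷ʳ xs a)))
                             (fromBottom-top x (xs ∷ʳ a))
      ... | no ne    = trans (fromBottom-below x (xs ∷ʳ a)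
                                (λ e → ne (ℕP.suc-injective (trans e (length-∷ʳ xs a)))))
                             (fromBottom-∷ʳ xs a n)

      fromBottom-∷ʳ-0 : ∀ (xs : List A) a → fromBottom (xs ∷ʳ a) 0 ≡ just a
      fromBottom-∷ʳ-0 []       a = refl
      fromBottom-∷ʳ-0 (x ∷ xs) a =
        trans (fromBottom-below x (xs ∷ʳ a) (λ e → ℕP.0≢1+n (trans e (length-∷ʳ xs a))))
              (fromBottom-∷ʳ-0 xs a)

      rest-empty : ∀ i n → fromBottom (lookup {A = List A} (Vec.replicate k []) i) n ≡ nothing
      rest-empty i n = cong (λ xs → fromBottom xs n) (VecP.lookup-replicate i [])

      rest-blank : ∀ i n → lookup {A = Maybe A} (Vec.replicate k nothing) i
                         ≡ fromBottom (lookup {A = List A} (Vec.replicate k []) i) n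
      rest-blank i n = trans (VecP.lookup-replicate i nothing) (sym (rest-empty i n))

      start-cells : ∀ w n → ∃ λ v → read (nth nothing (input w) n) ≡ just v ×
                    (∀ i → lookup v i ≡ fromBottom (lookup (initialStore w) i) n)
      start-cells []      n    = _ , refl , λ { zero → refl ; (suc i) → rest-blank i n }
      start-cells (a ∷ w) zero = _ , refl , λ { zero → bottom ; (suc i) → rest-blank i 0 }
        where
        bottom : just (letter a) ≡ fromBottom (reverse (map letter (a ∷ w))) 0
        bottom rewrite ListP.unfold-reverse (letter a) (map letter w) =
          sym (fromBottom-∷ʳ-0 (reverse (map letter w)) (letter a))
      start-cells (a ∷ w) (suc n) with start-cells w n
      ... | v , e , l = v , e , λ { zero → above
                                  ; (suc i) → trans (l (suc i)) (trans (rest-empty i n) (sym (rest-empty i (suc n)))) }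
        where
        above : lookup v zero ≡ fromBottom (reverse (map letter (a ∷ w))) (suc n)
        above rewrite ListP.unfold-reverse (letter a) (map letter w) =
          trans (l zero) (sym (fromBottom-∷ʳ (reverse (map letter w)) (letter a) n))

      start-represents : ∀ w → Represents (initialStore w) (startTape w)
      start-represents w .home  = refl
      start-represents w .cells = start-cells w

      split : ∀ w → ∃ λ a → ∃ λ r → initial machine w ≡ cfg zero [] a r ×
              a ≡ nth nothing (input w) 0 × (∀ m → nth nothing r m ≡ nth nothing (input w) (suc m))
      split []      = _ , _ , refl , refl , λ _ → refl
      split (a ∷ w) = _ , _ , refl , refl , λ _ → refl

    boot : ∀ w → ∃ λ c → Steps machine 2 (initial machine w) c × Ready (initialStore w) c
    boot w with split w
    ... | a , r , e , ea , er rewrite e =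
      _ , refl ◅ step-right machine {q = code mark} {h = nothing} [] (a ∷ r) (control-code mark nothing) ◅ ε ,
      startTape w , start-represents w ,
      shows refl (read-write nothing , tt) (cong read ea) (λ m → cong read (er m))

    search : ∀ w (σ : ℕ → Store) (found : ℕ → Bool) → σ 0 ≡ initialStore w →
      (∀ i → ∃ λ σ′ → (body ⊢ σ i ⇒ found i ∣ σ′) × (found i ≡ false → σ′ ≡ σ (suc i))) →
      HaltsOn machine w ⇔ ∃ λ i → found i ≡ true
    search w σ found e round with boot w
    ... | c , S , Rd = mk⇔ forth back
      where
      open Rounds σ found round
      Rd′ : Ready (σ 0) c
      Rd′ = subst (λ σ → Ready σ c) (sym e) Rd
      forth : HaltsOn machine w → ∃ λ i → found i ≡ true
      forth (n , H) with halts-after machine S n H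
      ... | n′ , _ , H′ = sound n′ (<-wellFounded n′) 0 Rd′ H′
      back : (∃ λ i → found i ≡ true) → HaltsOn machine w
      back (i , t) with complete i 0 Rd′ (subst (λ j → found j ≡ true) (sym (ℕP.+-identityʳ i)) t)
      ... | n , H = halts-before machine S n H

-- Alternation

elements : {K : Set} ⦃ _ : Finite K ⦄ → List K
elements ⦃ F ⦄ = map from (allFin (size ⦃ F ⦄))

∈-elements : {K : Set} ⦃ _ : Finite K ⦄ (v : K) → v ∈ elements
∈-elements v = subst (_∈ elements) (from∘to v) (∈-map⁺ from (∈-allFin (to v)))

-- A process in control state c consumes the letters u of its word R one at a time; for each of
-- them a reply v is chosen, by the existential player if `ex c` and by the universal one
-- otherwise, and v is remembered on L if `keep v`.  When R is exhausted the process has either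
-- succeeded or restarts on the remembered word.
module Alternation {C K : Set} ⦃ FK : Finite K ⦄
  (δ : C → K → K → C) (ex : C → Bool) (out : C → Maybe C) (keep : K → Bool) (pads : List K) where

  infixr 5 _▹_

  _▹_ : K → List K → List K
  v ▹ L = if keep v then v ∷ L else L

  -- The remembered letters lie latest first on L; the pads make room for a longer word in the next
  -- turn.
  next : List K → List K
  next L = reverse L ++ pads

  data Win : C → List K → List K → Set where
    any  : ∀ {c L u R} → ex c ≡ true → ∀ v → Win (δ c u v) (v ▹ L) R → Win c L (u ∷ R)
    all  : ∀ {c L u R} → ex c ≡ false → (∀ v → Win (δ c u v) (v ▹ L) R) → Win c L (u ∷ R)
    done : ∀ {c L} → out c ≡ nothing → Win c L []
    turn : ∀ {c L c′} → out c ≡ just c′ → Win c′ [] (next L) → Win c L []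

  Task : Set
  Task = C × List K × List K

  Won : Task → Set
  Won (c , L , R) = Win c L R

  child : C → List K → K → List K → K → Task
  child c L u R v = δ c u v , v ▹ L , R

  -- Serving a task always uses up one certificate letter, but only existential choices obey it.
  choices : C → K → List K
  choices c z = if ex c then [ z ] else elements

  restart : List K → Maybe C → List Task
  restart L nothing   = []
  restart L (just c′) = [ c′ , [] , next L ]

  expand : Task → K → List Task
  expand (c , L , u ∷ R) z = map (child c L u R) (choices c z)
  expand (c , L , [])    z = restart L (out c)

  work : List Task → K → List Task
  work []      z = []
  work (t ∷ O) z = expand t z ++ O

  -- The tasks O underneath are quantified over, so that certificates of several tasks can be
  -- concatenated.
  Clears : List Task → List K → Set
  Clears T zs = ∀ O → foldl work (T ++ O) zs ≡ O

  clears-++ : ∀ {T T′ zs zs′} → Clears T zs → Clears T′ zs′ → Clears (T ++ T′) (zs ++ zs′)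
  clears-++ {T} {T′} {zs} {zs′} p q O = begin
    foldl work ((T ++ T′) ++ O) (zs ++ zs′)       ≡⟨ ListP.foldl-++ work _ zs zs′ ⟩
    foldl work (foldl work ((T ++ T′) ++ O) zs) zs′
      ≡⟨ cong (λ X → foldl work (foldl work X zs) zs′) (ListP.++-assoc T T′ O) ⟩
    foldl work (foldl work (T ++ (T′ ++ O)) zs) zs′ ≡⟨ cong (λ X → foldl work X zs′) (p (T′ ++ O)) ⟩
    foldl work (T′ ++ O) zs′                        ≡⟨ q O ⟩
    O ∎
    where open ≡-Reasoning

  clears-all : (f : K → Task) → (∀ v → ∃ (Clears [ f v ])) → ∀ vs → ∃ (Clears (map f vs))
  clears-all f g []       = [] , λ _ → refl
  clears-all f g (v ∷ vs) with g v | clears-all f g vs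
  ... | zs , p | zs′ , q = zs ++ zs′ , clears-++ {[ f v ]} {map f vs} {zs} {zs′} p q

  certificate : K → ∀ {c L R} → Win c L R → ∃ (Clears [ c , L , R ])
  certificate z₀ {c} {L} {u ∷ R} (any e v w) with certificate z₀ w
  ... | zs , p = v ∷ zs , λ O → trans (cong (λ X → foldl work X zs) (first O)) (p O)
    where
    first : ∀ O → work ((c , L , u ∷ R) ∷ O) v ≡ child c L u R v ∷ O
    first O rewrite e = refl
  certificate z₀ {c} {L} {u ∷ R} (all e w)
    with clears-all (child c L u R) (λ v → certificate z₀ (w v)) elements
  -- A universal choice ignores its letter; `z₀` only fills the place.
  ... | zs , p = z₀ ∷ zs , λ O → trans (cong (λ X → foldl work X zs) (first O)) (p O)
    where
    first : ∀ O → work ((c , L , u ∷ R) ∷ O) z₀ ≡ map (child c L u R) elements ++ O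
    first O rewrite e = refl
  certificate z₀ {c} {L} (done e) = z₀ ∷ [] , λ O → cong (λ m → restart L m ++ O) e
  certificate z₀ {c} {L} (turn e w) with certificate z₀ w
  ... | zs , p = z₀ ∷ zs , λ O → trans (cong (λ m → foldl work (restart L m ++ O) zs) e) (p O)

  expand-sound : ∀ t z → All Won (expand t z) → Won t
  expand-sound (c , L , u ∷ R) z ws with ex c in e
  expand-sound (c , L , u ∷ R) z (w ∷ []) | true = any e z w
  ... | false = all e (λ v → All.lookup ws (∈-map⁺ (child c L u R) (∈-elements v)))
  expand-sound (c , L , []) z ws with out c in e
  expand-sound (c , L , []) z []       | nothing = done e
  expand-sound (c , L , []) z (w ∷ []) | just c′ = turn e w

  -- Read backwards from the empty list: `expand-sound` carries winning from the instances of a task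
  -- to the task. Surplus letters do no harm, as an empty list stays empty.
  work-sound : ∀ O zs → foldl work O zs ≡ [] → All Won O
  work-sound O       []       refl = []
  work-sound []      (z ∷ zs) e = []
  work-sound (t ∷ O) (z ∷ zs) e with AllP.++⁻ (expand t z) (work-sound (expand t z ++ O) zs e)
  ... | wt , wO = expand-sound t z wt ∷ wO

  win⇔certificate : K → ∀ {c L R} → Win c L R ⇔ ∃ λ zs → foldl work [ c , L , R ] zs ≡ []
  win⇔certificate z₀ = mk⇔
    (λ w → let zs , p = certificate z₀ w in zs , p [])
    (λ { (zs , e) → All.head (work-sound _ zs e) })

-- Instructions merged into one automaton

record Automaton (Σ′ : Set) : Set₁ where
  field
    S      : Set
    finite : Finite S
    start  : S
    δ      : S → Σ′ → S
    final  : S → Bool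

  acceptsFrom : S → List Σ′ → Bool
  acceptsFrom q w = final (foldl δ q w)

module _ {g : ℕ} where

  -- The product construction. The choice of an instruction thus needs no move of its own: `union⁻`
  -- recovers one from the accepted pair of words.
  union : List (Instruction g) → Automaton (ConvAlph g)
  union []       = record { S = ⊤ ; finite = Finite-⊤ ; start = tt ; δ = λ _ _ → tt ; final = λ _ → false }
  union (J ∷ Js) = record
    { S      = Fin (suc D.nStates) × U.S
    ; finite = Finite-× ⦃ Finite-Fin ⦄ ⦃ U.finite ⦄
    ; start  = D.start , U.start
    ; δ      = λ (p , q) a → D.δ p a , U.δ q a
    ; final  = λ (p , q) → D.final p ∨ U.final q }
    where
    module D = DFA (Instruction.auto J)
    module U = Automaton (union Js)

  module _ (Js : List (Instruction g)) where
    open Automaton (union Js) public using () renaming (acceptsFrom to unionFrom; start to unionStart)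

  union-∷ : ∀ J Js w → unionFrom (J ∷ Js) (unionStart (J ∷ Js)) w
                     ≡ accepts (Instruction.auto J) w ∨ unionFrom Js (unionStart Js) w
  union-∷ J Js w = go w (D.start) (U.start)
    where
    module D = DFA (Instruction.auto J)
    module U = Automaton (union Js)
    go : ∀ w p q → unionFrom (J ∷ Js) (p , q) w ≡ D.final (foldl D.δ p w) ∨ unionFrom Js q w
    go []      p q = refl
    go (a ∷ w) p q = go w (D.δ p a) (U.δ q a)

  union⁺ : ∀ {J Js} → J ∈ Js → ∀ {x y} → Rel J x y → unionFrom Js (unionStart Js) (conv x y) ≡ true
  union⁺ {Js = J ∷ Js} (here refl) {x} {y} r rewrite union-∷ J Js (conv x y) | r = refl
  union⁺ {Js = J ∷ Js} (there m)   {x} {y} r rewrite union-∷ J Js (conv x y) | union⁺ m {x} {y} r =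
    BoolP.∨-zeroʳ _

  union⁻ : ∀ Js {x y} → unionFrom Js (unionStart Js) (conv x y) ≡ true → ∃ λ J → J ∈ Js × Rel J x y
  union⁻ (J ∷ Js) {x} {y} e rewrite union-∷ J Js (conv x y) with accepts (Instruction.auto J) (conv x y) in eq
  ... | true  = J , here refl , eq
  ... | false with union⁻ Js {x} {y} e
  ... | J′ , m , r = J′ , there m , r

  maxBound : List (Instruction g) → ℕ
  maxBound []       = 0
  maxBound (J ∷ Js) = Instruction.bound J ⊔ maxBound Js

  bound≤max : ∀ {J Js} → J ∈ Js → Instruction.bound J ≤ maxBound Js
  bound≤max (here refl)       = ℕP.m≤m⊔n _ _
  bound≤max {Js = J ∷ _} (there m) = ℕP.≤-trans (bound≤max m) (ℕP.m≤n⊔m (Instruction.bound J) _)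

  rel-length : ∀ {J Js N} → J ∈ Js → maxBound Js ≤ N → ∀ {x y} → Rel J x y → length y ≤ length x + N
  rel-length {J} m le {x} {y} r =
    ℕP.≤-trans (proj₁ (Instruction.bounded J x y r)) (ℕP.+-monoʳ-≤ (length x) (ℕP.≤-trans (bound≤max m) le))

-- The game as an alternating process

module Game {s : ℕ} (M : AARM s) where

  open AARM M

  module UA = Automaton (union A)
  module UB = Automaton (union B)

  K : Set
  K = Maybe (Fin g)

  -- A common bound for both players: a register followed by N pads has a position for every letter
  -- of any legal new content.
  N : ℕ
  N = maxBound A ⊔ maxBound B

  -- The Booleans of the two running modes record that the chosen word has ended.
  C : Set
  C = Bool ⊎ (UA.S × Bool) ⊎ (UB.S × Bool)

  pattern settled b = inj₁ b
  pattern anke q e  = inj₂ (inj₁ (q , e))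
  pattern boris q e = inj₂ (inj₂ (q , e))

  finiteC : Finite C
  finiteC = Finite-⊎ ⦃ Finite-Bool ⦄
    ⦃ Finite-⊎ ⦃ Finite-× ⦃ UA.finite ⦄ ⦃ Finite-Bool ⦄ ⦄ ⦃ Finite-× ⦃ UB.finite ⦄ ⦃ Finite-Bool ⦄ ⦄ ⦄

  -- `nothing` rejects a chosen word that resumes after its end.
  advance : {S : Set} → (S → ConvAlph g → S) → S × Bool → K → K → Maybe (S × Bool)
  -- Here both words have ended: the position lies beyond the convolution, so the automaton reads
  -- nothing.
  advance δ (q , e)     nothing  nothing  = just (q , true)
  advance δ (q , e)     (just a) nothing  = just (δ q (just a , nothing) , true)
  advance δ (q , false) nothing  (just b) = just (δ q (nothing , just b) , false)
  advance δ (q , false) (just a) (just b) = just (δ q (just a , just b) , false)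
  advance δ (q , true)  nothing  (just b) = nothing
  advance δ (q , true)  (just a) (just b) = nothing

  -- A player who resumes a word after its end forfeits: the process is settled against Anke or in
  -- her favour, respectively.
  δ : C → K → K → C
  δ (settled b)     u v = settled b
  δ (inj₂ (inj₁ p)) u v = maybe′ (inj₂ ∘ inj₁) (settled false) (advance UA.δ p u v)
  δ (inj₂ (inj₂ p)) u v = maybe′ (inj₂ ∘ inj₂) (settled true) (advance UB.δ p u v)

  ex : C → Bool
  ex (settled _) = true
  ex (anke _ _)  = true
  ex (boris _ _) = false

  anke₀ boris₀ : C
  anke₀  = anke UA.start false
  boris₀ = boris UB.start false

  out : C → Maybe C
  out (settled true)  = nothing
  -- A lost process restarts for ever, so it has no finite derivation of `Win`.
  out (settled false) = just (settled false)
  out (anke q _)      = just (if UA.final q then boris₀ else settled false)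
  -- An illegal word of Boris is a success. In effect the universal choice ranges over his legal
  -- replies, and Anke wins when there are none.
  out (boris q _)     = if UB.final q then just anke₀ else nothing

  open Alternation δ ex out is-just (replicate N nothing) public

  padded : Word g → ℕ → List K
  padded x n = map just x ++ replicate n nothing

  pushes : List K → Word g → List K
  pushes L []      = L
  pushes L (b ∷ y) = pushes (just b ∷ L) y

  pushes-reverse : ∀ p y → pushes (map just (reverse p)) y ≡ map just (reverse (p ++ y))
  pushes-reverse p []      = cong (map just ∘ reverse) (sym (ListP.++-identityʳ p))
  pushes-reverse p (b ∷ y) = begin
    pushes (just b ∷ map just (reverse p)) y ≡⟨ cong (λ r → pushes (map just r) y) (sym (ListP.reverse-++ p [ b ])) ⟩
    pushes (map just (reverse (p ++ [ b ]))) y ≡⟨ pushes-reverse (p ++ [ b ]) y ⟩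
    map just (reverse ((p ++ [ b ]) ++ y))     ≡⟨ cong (map just ∘ reverse) (ListP.++-assoc p [ b ] y) ⟩
    map just (reverse (p ++ b ∷ y)) ∎
    where open ≡-Reasoning

  next-reverse : ∀ p → next (map just (reverse p)) ≡ padded p N
  next-reverse p = cong (_++ replicate N nothing) (begin
    reverse (map just (reverse p)) ≡⟨ cong reverse (ListP.reverse-map just p) ⟩
    reverse (reverse (map just p)) ≡⟨ ListP.reverse-involutive (map just p) ⟩
    map just p ∎)
    where open ≡-Reasoning

  next-pushes : ∀ y → next (pushes [] y) ≡ padded y N
  next-pushes y = trans (cong next (pushes-reverse [] y)) (next-reverse y)

  lost : ∀ {L R} → Win (settled false) L R → ⊥
  lost (any _ _ w)   = lost w
  lost (turn refl w) = lost w

  won : ∀ L R → Win (settled true) L R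
  won L []      = done refl
  won L (u ∷ R) = any refl nothing (won L R)

  module _ {L : List K} where

    afterA : ∀ {q e} → UA.final q ≡ true → Win boris₀ [] (next L) → Win (anke q e) L []
    afterA {q} f w = turn (cong (λ b → just (if b then boris₀ else settled false)) f) w

    afterB : ∀ {q e} → (UB.final q ≡ true → Win anke₀ [] (next L)) → Win (boris q e) L []
    afterB {q} h with UB.final q in f
    ... | true  = turn (cong (λ b → if b then just anke₀ else nothing) f) (h refl)
    ... | false = done (cong (λ b → if b then just anke₀ else nothing) f)

    anke-idle : ∀ x n {q e} → UA.acceptsFrom q (conv x []) ≡ true → Win boris₀ [] (next L) →
                Win (anke q e) L (padded x n)
    anke-idle []      zero    f w = afterA f w
    anke-idle []      (suc n) f w = any refl nothing (anke-idle [] n f w)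
    anke-idle (a ∷ x) n       f w = any refl nothing (anke-idle x n f w)

    boris-idle : ∀ x n {q} → (UB.acceptsFrom q (conv x []) ≡ true → Win anke₀ [] (next L)) →
                 Win (boris q true) L (padded x n)
    boris-idle []      zero    h = afterB h
    boris-idle []      (suc n) h = all refl λ { nothing → boris-idle [] n h ; (just _) → won _ _ }
    boris-idle (a ∷ x) n       h = all refl λ { nothing → boris-idle x n h ; (just _) → won _ _ }

  anke-choose : ∀ x n y {q L} → length y ≤ length x + n → UA.acceptsFrom q (conv x y) ≡ true →
                Win boris₀ [] (next (pushes L y)) → Win (anke q false) L (padded x n)
  anke-choose x       n       []      le       f w = anke-idle x n f w
  anke-choose []      (suc n) (b ∷ y) (s≤s le) f w = any refl (just b) (anke-choose [] n y le f w)
  anke-choose (a ∷ x) n       (b ∷ y) (s≤s le) f w = any refl (just b) (anke-choose x n y le f w)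

  boris-choose : ∀ x n {q L} →
    (∀ y → UB.acceptsFrom q (conv x y) ≡ true → Win anke₀ [] (next (pushes L y))) →
    Win (boris q false) L (padded x n)
  boris-choose []      zero    h = afterB (h [])
  boris-choose []      (suc n) h = all refl λ
    { nothing  → boris-idle [] n (h [])
    ; (just b) → boris-choose [] n (λ y → h (b ∷ y)) }
  boris-choose (a ∷ x) n       h = all refl λ
    { nothing  → boris-idle x n (h [])
    ; (just b) → boris-choose x n (λ y → h (b ∷ y)) }

  complete : ∀ {r} → AnkeWins M r → Win anke₀ [] (padded r N)
  complete {r} (move J J∈A x r→x reply) =
    anke-choose r N x (rel-length J∈A (ℕP.m≤m⊔n _ _) {r} {x} r→x) (union⁺ J∈A {r} {x} r→x)
      (subst (Win boris₀ []) (sym (next-pushes x)) (boris-choose x N answer))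
    where
    answer : ∀ y → UB.acceptsFrom UB.start (conv x y) ≡ true → Win anke₀ [] (next (pushes [] y))
    answer y f with union⁻ B {x} {y} f
    ... | J′ , J′∈B , x→y = subst (Win anke₀ []) (sym (next-pushes y)) (complete (reply J′ J′∈B y x→y))

  BorisLoses : Word g → Set
  BorisLoses x = ∀ J → J ∈ B → ∀ y → Rel J x y → AnkeWins M y

  snoc-reverse : ∀ {L} (p : Word g) b → L ≡ map just (reverse p) → just b ∷ L ≡ map just (reverse (p ++ [ b ]))
  snoc-reverse p b refl = cong (map just) (sym (ListP.reverse-++ p [ b ]))

  end-register : ∀ p {L} → L ≡ map just (reverse p) → next L ≡ padded (p ++ []) N
  end-register p eL = trans (cong next eL) (trans (next-reverse p)
                        (cong (λ p → padded p N) (sym (ListP.++-identityʳ p))))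

  accepted : ∀ {q c} → UB.final q ≡ true → (if UB.final q then just anke₀ else nothing) ≡ c → c ≡ just anke₀
  accepted f e rewrite f = sym e

  -- p is the part of the new register content that has been chosen so far.  R is kept apart from
  -- `padded x n`, and likewise L, so that the recursion is structural in the derivation of Win.
  mutual
    anke-wins : ∀ r {R} → R ≡ padded r N → Win anke₀ [] R → AnkeWins M r
    anke-wins r eR w with anke-sound r N [] refl eR w
    ... | y , f , l with union⁻ A {r} {y} f
    ... | J , J∈A , r→y = move J J∈A y r→y l

    anke-sound : ∀ x n p {q L R} → L ≡ map just (reverse p) → R ≡ padded x n → Win (anke q false) L R →
                 ∃ λ y → UA.acceptsFrom q (conv x y) ≡ true × BorisLoses (p ++ y)
    anke-sound []      zero    p eL refl (turn refl w) = [] , anke-end p eL w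
    anke-sound []      (suc n) p eL refl (any _ nothing w)  = [] , anke-idle-sound [] n p eL refl w
    anke-sound []      (suc n) p eL refl (any _ (just b) w)
      with anke-sound [] n (p ++ [ b ]) (snoc-reverse p b eL) refl w
    ... | y , f , l = b ∷ y , f , subst BorisLoses (ListP.++-assoc p [ b ] y) l
    anke-sound (a ∷ x) n       p eL refl (any _ nothing w)  = [] , anke-idle-sound x n p eL refl w
    anke-sound (a ∷ x) n       p eL refl (any _ (just b) w)
      with anke-sound x n (p ++ [ b ]) (snoc-reverse p b eL) refl w
    ... | y , f , l = b ∷ y , f , subst BorisLoses (ListP.++-assoc p [ b ] y) l

    anke-idle-sound : ∀ x n p {q L R} → L ≡ map just (reverse p) → R ≡ padded x n → Win (anke q true) L R →
                      UA.acceptsFrom q (conv x []) ≡ true × BorisLoses (p ++ [])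
    anke-idle-sound []      zero    p eL refl (turn refl w)      = anke-end p eL w
    anke-idle-sound []      (suc n) p eL refl (any _ nothing w)  = anke-idle-sound [] n p eL refl w
    anke-idle-sound []      (suc n) p eL refl (any _ (just b) w) = ⊥-elim (lost w)
    anke-idle-sound (a ∷ x) n       p eL refl (any _ nothing w)  = anke-idle-sound x n p eL refl w
    anke-idle-sound (a ∷ x) n       p eL refl (any _ (just b) w) = ⊥-elim (lost w)

    anke-end : ∀ p {q L} → L ≡ map just (reverse p) →
               Win (if UA.final q then boris₀ else settled false) [] (next L) →
               UA.final q ≡ true × BorisLoses (p ++ [])
    anke-end p {q} eL w with UA.final q
    ... | false = ⊥-elim (lost w)
    ... | true  = refl , λ J J∈B y r → boris-sound (p ++ []) N [] refl
                    (end-register p eL) w y (rel-length J∈B (ℕP.m≤n⊔m (maxBound A) _) {p ++ []} {y} r) (union⁺ J∈B {p ++ []} {y} r)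

    -- The universal choices are instantiated with the letters of y and then with end marks. The
    -- length condition, which boundedness yields for legal replies, ensures that y fits into R.
    boris-sound : ∀ x n p {q L R} → L ≡ map just (reverse p) → R ≡ padded x n → Win (boris q false) L R →
                  ∀ y → length y ≤ length x + n → UB.acceptsFrom q (conv x y) ≡ true → AnkeWins M (p ++ y)
    boris-sound []      zero    p eL refl (done e)   []      le f with accepted f e
    ... | ()
    boris-sound []      zero    p eL refl (turn e w) []      le f with accepted f e
    ... | refl = anke-wins (p ++ []) (end-register p eL) w
    boris-sound []      (suc n) p eL refl (all _ h)  []      le f = boris-idle-sound [] n p eL refl (h nothing) f
    boris-sound []      (suc n) p eL refl (all _ h)  (b ∷ y) (s≤s le) f =
      subst (AnkeWins M) (ListP.++-assoc p [ b ] y)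
        (boris-sound [] n (p ++ [ b ]) (snoc-reverse p b eL) refl (h (just b)) y le f)
    boris-sound (a ∷ x) n       p eL refl (all _ h)  []      le f = boris-idle-sound x n p eL refl (h nothing) f
    boris-sound (a ∷ x) n       p eL refl (all _ h)  (b ∷ y) (s≤s le) f =
      subst (AnkeWins M) (ListP.++-assoc p [ b ] y)
        (boris-sound x n (p ++ [ b ]) (snoc-reverse p b eL) refl (h (just b)) y le f)

    boris-idle-sound : ∀ x n p {q L R} → L ≡ map just (reverse p) → R ≡ padded x n → Win (boris q true) L R →
                       UB.acceptsFrom q (conv x []) ≡ true → AnkeWins M (p ++ [])
    boris-idle-sound []      zero    p eL refl (done e)   f with accepted f e
    ... | ()
    boris-idle-sound []      zero    p eL refl (turn e w) f with accepted f e
    ... | refl = anke-wins (p ++ []) (end-register p eL) w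
    boris-idle-sound []      (suc n) p eL refl (all _ h)  f = boris-idle-sound [] n p eL refl (h nothing) f
    boris-idle-sound (a ∷ x) n       p eL refl (all _ h)  f = boris-idle-sound x n p eL refl (h nothing) f

  game : ∀ r → AnkeWins M r ⇔ Win anke₀ [] (padded r N)
  game r = mk⇔ complete (anke-wins r refl)

-- A Turing machine searching for certificates

module Counting (m : ℕ) where

  Digit : Set
  Digit = Fin (suc m)

  succ? : ∀ {m} → Fin (suc m) → Maybe (Fin (suc m))
  succ? {zero}  zero    = nothing
  succ? {suc m} zero    = just (suc zero)
  succ? {suc m} (suc i) = Maybe.map suc (succ? i)

  succ?-max : ∀ m → succ? (fromℕ m) ≡ nothing
  succ?-max zero    = refl
  succ?-max (suc m) = cong (Maybe.map suc) (succ?-max m)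

  succ?-induction : ∀ {m} (P : Fin (suc m) → Set) → P zero →
                    (∀ {i j} → succ? i ≡ just j → P i → P j) → ∀ i → P i
  succ?-induction         P base ind zero    = base
  succ?-induction {suc m} P base ind (suc i) =
    succ?-induction (P ∘ suc) (ind refl base) (λ e → ind (cong (Maybe.map suc) e)) i

  -- Bijective numeration with the least digit first: a carry out of the last digit appends a zero,
  -- so lists of every length occur, including those that end in zeros.
  increment : List Digit → List Digit
  increment []       = [ zero ]
  increment (d ∷ ds) with succ? d
  ... | just d′ = d′ ∷ ds
  ... | nothing = zero ∷ increment ds

  count : ℕ → List Digit
  count zero    = []
  count (suc n) = increment (count n)

  count-cons : ∀ n d → ∃ λ n′ → count n′ ≡ d ∷ count n
  count-cons n = succ?-induction _ (first n) carry-free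
    where
    carry-free : ∀ {d d′ ds} → succ? d ≡ just d′ → (∃ λ n → count n ≡ d ∷ ds) → ∃ λ n → count n ≡ d′ ∷ ds
    carry-free {d} {d′} {ds} e (n , e′) = suc n , trans (cong increment e′) lemma
      where
      lemma : increment (d ∷ ds) ≡ d′ ∷ ds
      lemma rewrite e = refl
    first : ∀ n → ∃ λ n′ → count n′ ≡ zero ∷ count n
    first zero = 1 , refl
    -- With the largest digit in front of `count n`, the next increment resets it to zero and
    -- carries into `count n`.
    first (suc n) with count-cons n (fromℕ m)
    ... | n′ , e = suc n′ , trans (cong increment e) lemma
      where
      lemma : increment (fromℕ m ∷ count n) ≡ zero ∷ increment (count n)
      lemma rewrite succ?-max m = refl

  count-surjective : ∀ ds → ∃ λ n → count n ≡ ds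
  count-surjective []       = 0 , refl
  count-surjective (d ∷ ds) with count-surjective ds
  ... | n , refl = count-cons n d

-- The certificate checker as a stack program

module Checker {s : ℕ} {C K : Set} ⦃ FC : Finite C ⦄ ⦃ FK : Finite K ⦄
  (δ : C → K → K → C) (ex : C → Bool) (out : C → Maybe C) (keep : K → Bool) (pads : List K)
  (c₀ : C) (k₀ : K) (letter : Fin s → K) where

  open Alternation δ ex out keep pads
  open Counting (size {K})

  -- `Counting` works with digits of the form `Fin (suc m)`, so there is one extra digit, a second
  -- name for `k₀`; surjectivity is enough.
  digit : Digit → K
  digit zero    = k₀
  digit (suc i) = from i

  digit-surjective : ∀ zs → ∃ λ ds → map digit ds ≡ zs
  digit-surjective []       = [] , refl
  digit-surjective (z ∷ zs) with digit-surjective zs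
  ... | ds , refl = suc (to z) ∷ ds , cong (_∷ _) (from∘to z)

  data Symbol : Set where
    sep : Symbol
    ctl : C → Symbol
    key : K → Symbol
    dig : Digit → Symbol

  instance
    Finite-Symbol : Finite Symbol
    Finite-Symbol = retract f g gf (Finite-⊎ {⊤} {C ⊎ K ⊎ Digit})
      where
      f : Symbol → ⊤ ⊎ C ⊎ K ⊎ Digit
      f sep     = inj₁ tt
      f (ctl c) = inj₂ (inj₁ c)
      f (key v) = inj₂ (inj₂ (inj₁ v))
      f (dig d) = inj₂ (inj₂ (inj₂ d))
      g : ⊤ ⊎ C ⊎ K ⊎ Digit → Symbol
      g (inj₁ _)               = sep
      g (inj₂ (inj₁ c))        = ctl c
      g (inj₂ (inj₂ (inj₁ v))) = key v
      g (inj₂ (inj₂ (inj₂ d))) = dig d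
      gf : ∀ a → g (f a) ≡ a
      gf sep     = refl
      gf (ctl _) = refl
      gf (key _) = refl
      gf (dig _) = refl

  open StackMachine 9 Symbol public

  -- The tasks are spread over three stacks: OC holds their controls, OL and OR their two lists,
  -- each closed by a separator.
  pattern W  = zero
  pattern Z  = suc zero
  pattern Y  = suc (suc zero)
  pattern OC = suc (suc (suc zero))
  pattern OL = suc (suc (suc (suc zero)))
  pattern OR = suc (suc (suc (suc (suc zero))))
  pattern TL = suc (suc (suc (suc (suc (suc zero)))))
  pattern TR = suc (suc (suc (suc (suc (suc (suc zero))))))
  pattern U  = suc (suc (suc (suc (suc (suc (suc (suc zero)))))))

  Symbols : Set
  Symbols = List Symbol

  controls : List Task → Symbols
  controls = map (ctl ∘ proj₁)

  lefts rights : List Task → Symbols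
  lefts []                = []
  lefts ((_ , L , _) ∷ O) = map key L ++ sep ∷ lefts O
  rights []                = []
  rights ((_ , _ , R) ∷ O) = map key R ++ sep ∷ rights O

  isSep : Symbol → Bool
  isSep sep = true
  isSep _   = false

  never : Symbol → Bool
  never _ = false

  sweep-body : (Symbol → Bool) → Fin 9 → (Symbol → Prog ⊤) → ⊤ → Prog (⊤ ⊎ ⊤)
  sweep-body stop i f _ = pop i >>= λ
    { nothing  → ret (inj₂ tt)
    ; (just a) → if stop a then ret (inj₂ tt) else (f a >> ret (inj₁ tt)) }

  sweep : (Symbol → Bool) → Fin 9 → (Symbol → Prog ⊤) → Prog ⊤
  sweep stop i f = iter (sweep-body stop i f) tt

  -- σ xs x is the store in which stack i holds xs and the rest of the store encodes x.
  module _ {X : Set} {stop : Symbol → Bool} (i : Fin 9) (f : Symbol → Prog ⊤)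
           (σ : Symbols → X → Store) (F : X → Symbol → X)
           (get : ∀ xs x → lookup (σ xs x) i ≡ xs)
           (set : ∀ xs x ys → σ xs x [ i ]≔ ys ≡ σ ys x) where

    private
      pop-σ : ∀ {a xs x} → pop i ⊢ σ (a ∷ xs) x ⇒ just a ∣ σ xs x
      pop-σ {a} {xs} {x} = subst (λ s → pop i ⊢ σ (a ∷ xs) x ⇒ just a ∣ s) (set (a ∷ xs) x xs)
                             (pop-∷ (get (a ∷ xs) x))

      continue : ∀ {a xs x} → stop a ≡ false → f a ⊢ σ xs x ⇒ tt ∣ σ xs (F x a) →
                 sweep-body stop i f tt ⊢ σ (a ∷ xs) x ⇒ inj₁ tt ∣ σ xs (F x a)
      continue {a} {xs} {x} e D = pop-σ ⟫ go
        where
        go : (if stop a then ret (inj₂ tt) else (f a >> ret (inj₁ tt))) ⊢ σ xs x ⇒ inj₁ tt ∣ σ xs (F x a)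
        go rewrite e = D ⟫ ret

    Handles : Symbol → Set₁
    Handles a = stop a ≡ false × (∀ xs x → f a ⊢ σ xs x ⇒ tt ∣ σ xs (F x a))

    sweep-until : ∀ {seg b rest} → All Handles seg → stop b ≡ true → ∀ x →
                  sweep stop i f ⊢ σ (seg ++ b ∷ rest) x ⇒ tt ∣ σ rest (foldl F x seg)
    sweep-until {b = b} {rest} [] e x = leave (pop-σ ⟫ go)
      where
      go : (if stop b then ret (inj₂ tt) else (f b >> ret (inj₁ tt))) ⊢ σ rest x ⇒ inj₂ tt ∣ σ rest x
      go rewrite e = ret
    sweep-until ((n , h) ∷ hs) e x = again (continue n (h _ x)) (sweep-until hs e _)

    sweep-all : ∀ {seg} → All Handles seg → ∀ x →
                sweep stop i f ⊢ σ seg x ⇒ tt ∣ σ [] (foldl F x seg)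
    sweep-all []             x = leave (pop-[] (get [] x) ⟫ ret)
    sweep-all ((n , h) ∷ hs) x = again (continue n (h _ x)) (sweep-all hs _)

  keys : ∀ {P : Symbol → Set₁} → (∀ v → P (key v)) → ∀ L → All P (map key L)
  keys h L = AllP.map⁺ (All.universal h L)

  pour : Fin 9 → Fin 9 → Prog ⊤
  pour i j = sweep never i (push j)

  load : Fin 9 → Fin 9 → Prog ⊤
  load i j = sweep isSep i (push j)

  clear : Fin 9 → Prog ⊤
  clear i = sweep never i (λ _ → ret tt)

  pushTo : Symbols → Symbol → Symbols
  pushTo = flip _∷_

  pushKeys : Fin 9 → List K → Prog ⊤
  pushKeys i []       = ret tt
  pushKeys i (v ∷ vs) = pushKeys i vs >> push i (key v)

  -- Reading a stack destroys it, so a second copy goes to `U` and is poured back. Stack i receives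
  -- the symbols in reversed order.
  copyBack : Fin 9 → Fin 9 → Prog ⊤
  copyBack j i = sweep never j (λ a → push i a >> push U a) >> pour U j

  module _ (i j : Fin 9) (σ : Symbols → Symbols → Symbols → Store)
    (getJ : ∀ xs ys zs → lookup (σ xs ys zs) j ≡ ys)
    (getI : ∀ xs ys zs → lookup (σ xs ys zs) i ≡ xs)
    (getU : ∀ xs ys zs → lookup (σ xs ys zs) U ≡ zs)
    (setJ : ∀ xs ys zs ys′ → σ xs ys zs [ j ]≔ ys′ ≡ σ xs ys′ zs)
    (setI : ∀ xs ys zs xs′ → σ xs ys zs [ i ]≔ xs′ ≡ σ xs′ ys zs)
    (setU : ∀ xs ys zs zs′ → σ xs ys zs [ U ]≔ zs′ ≡ σ xs ys zs′) where

    private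
      on-I : ∀ {a xs ys zs} → push i a ⊢ σ xs ys zs ⇒ tt ∣ σ (a ∷ xs) ys zs
      on-I {a} {xs} {ys} {zs} = subst (λ s → push i a ⊢ σ xs ys zs ⇒ tt ∣ s)
        (trans (cong (λ t → σ xs ys zs [ i ]≔ (a ∷ t)) (getI xs ys zs)) (setI xs ys zs (a ∷ xs))) push

      on-J : ∀ {a xs ys zs} → push j a ⊢ σ xs ys zs ⇒ tt ∣ σ xs (a ∷ ys) zs
      on-J {a} {xs} {ys} {zs} = subst (λ s → push j a ⊢ σ xs ys zs ⇒ tt ∣ s)
        (trans (cong (λ t → σ xs ys zs [ j ]≔ (a ∷ t)) (getJ xs ys zs)) (setJ xs ys zs (a ∷ ys))) push

      on-U : ∀ {a xs ys zs} → push U a ⊢ σ xs ys zs ⇒ tt ∣ σ xs ys (a ∷ zs)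
      on-U {a} {xs} {ys} {zs} = subst (λ s → push U a ⊢ σ xs ys zs ⇒ tt ∣ s)
        (trans (cong (λ t → σ xs ys zs [ U ]≔ (a ∷ t)) (getU xs ys zs)) (setU xs ys zs (a ∷ zs))) push

      foldl-pair : ∀ seg (xs zs : Symbols) →
        foldl (λ (xs , zs) a → (a ∷ xs) , (a ∷ zs)) (xs , zs) seg ≡ (seg ʳ++ xs , seg ʳ++ zs)
      foldl-pair []        xs zs = refl
      foldl-pair (a ∷ seg) xs zs = foldl-pair seg (a ∷ xs) (a ∷ zs)

    copyBack-spec : ∀ seg xs → copyBack j i ⊢ σ xs seg [] ⇒ tt ∣ σ (seg ʳ++ xs) seg []
    copyBack-spec seg xs =
      subst (λ (xs′ , zs′) → sweep never j (λ a → push i a >> push U a) ⊢ σ xs seg [] ⇒ tt ∣ σ xs′ [] zs′)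
        (foldl-pair seg xs [])
        (sweep-all {stop = never} j _ (λ ys (xs , zs) → σ xs ys zs) (λ (xs , zs) a → (a ∷ xs) , (a ∷ zs))
          (λ ys (xs , zs) → getJ xs ys zs) (λ ys (xs , zs) → setJ xs ys zs)
          (All.universal (λ _ → refl , λ _ _ → on-I ⟫ on-U) seg) (xs , []))
      ⟫ subst (λ ys → pour U j ⊢ σ (seg ʳ++ xs) [] (reverse seg) ⇒ tt ∣ σ (seg ʳ++ xs) ys [])
        (ListP.reverse-involutive seg)
        (sweep-all {stop = never} U _ (λ zs ys → σ (seg ʳ++ xs) ys zs) pushTo
          (λ zs ys → getU _ ys zs) (λ zs ys → setU _ ys zs)
          (All.universal (λ _ → refl , λ _ _ → on-J) (reverse seg)) [])

  -- `load` has left the two lists reversed on TL and TR, so copying restores their order and keeps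
  -- them for the other children.
  spawn : C → K → K → Prog ⊤
  spawn c u v = push OL sep >> copyBack TL OL >> (if keep v then push OL (key v) else ret tt) >>
                push OR sep >> copyBack TR OR >> push OC (ctl (δ c u v))

  -- The last child is spawned first, so that the first one ends up on top, as in `work`.
  spawns : C → K → List K → Prog ⊤
  spawns c u []       = ret tt
  spawns c u (v ∷ vs) = spawns c u vs >> spawn c u v

  branch : C → K → K → Prog ⊤
  branch c u z = load OL TL >> load OR TR >> spawns c u (choices c z) >> clear TL >> clear TR

  finish : Maybe C → Prog ⊤
  finish nothing   = load OL TL >> clear TL
  -- Unloading L on top of the pads reverses it, which is just `next L`.
  finish (just c′) = push OR sep >> pushKeys OR pads >> load OL OR >> push OL sep >> push OC (ctl c′)

  serve : K → Prog ⊤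
  serve z = pop OC >>= λ
    { (just (ctl c)) → pop OR >>= λ
        { (just (key u)) → branch c u z
        ; (just sep)     → finish (out c)
        ; _              → ret tt }
    ; _ → ret tt }

  -- W keeps the input, Z the counter, Y the unread part of the certificate, and TL and TR the lists
  -- of the task being expanded. The scratch stack U is empty between subroutines.
  ⟨_,_,_,_,_,_⟩ : Symbols → Symbols → Symbols → Symbols → Symbols → List Task → Store
  ⟨ w , z , y , tl , tr , O ⟩ = w ∷ z ∷ y ∷ controls O ∷ lefts O ∷ rights O ∷ tl ∷ tr ∷ [] ∷ []

  reverse-keys : ∀ L (xs : Symbols) → map key (reverse L) ʳ++ xs ≡ map key L ++ xs
  reverse-keys L xs = begin
    map key (reverse L) ʳ++ xs    ≡⟨ cong (_ʳ++ xs) (ListP.reverse-map key L) ⟩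
    reverse (map key L) ʳ++ xs    ≡⟨ ListP.ʳ++-defn (reverse (map key L)) ⟩
    reverse (reverse (map key L)) ++ xs ≡⟨ cong (_++ xs) (ListP.reverse-involutive (map key L)) ⟩
    map key L ++ xs ∎
    where open ≡-Reasoning

  module _ (w z y : Symbols) where

    spawn-spec : ∀ c u v L R O →
      spawn c u v ⊢ ⟨ w , z , y , map key (reverse L) , map key (reverse R) , O ⟩ ⇒ tt ∣
                    ⟨ w , z , y , map key (reverse L) , map key (reverse R) , child c L u R v ∷ O ⟩
    spawn-spec c u v L R O = push ⟫ copyL ⟫ kept ⟫ push ⟫ copyR ⟫ push
      where
      tl = map key (reverse L)
      tr = map key (reverse R)
      σL σR : Symbols → Symbols → Symbols → Store
      σL ol t u′ = w ∷ z ∷ y ∷ controls O ∷ ol ∷ rights O ∷ t ∷ tr ∷ u′ ∷ []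
      σR or t u′ = w ∷ z ∷ y ∷ controls O ∷ (map key (v ▹ L) ++ sep ∷ lefts O) ∷ or ∷ tl ∷ t ∷ u′ ∷ []
      copyL : copyBack TL OL ⊢ σL (sep ∷ lefts O) tl [] ⇒ tt ∣ σL (map key L ++ sep ∷ lefts O) tl []
      copyL = subst (λ ol → copyBack TL OL ⊢ σL (sep ∷ lefts O) tl [] ⇒ tt ∣ σL ol tl [])
        (reverse-keys L _)
        (copyBack-spec OL TL σL (λ _ _ _ → refl) (λ _ _ _ → refl) (λ _ _ _ → refl)
          (λ _ _ _ _ → refl) (λ _ _ _ _ → refl) (λ _ _ _ _ → refl) tl (sep ∷ lefts O))
      kept : (if keep v then push OL (key v) else ret tt) ⊢ σL (map key L ++ sep ∷ lefts O) tl []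
             ⇒ tt ∣ σL (map key (v ▹ L) ++ sep ∷ lefts O) tl []
      kept with keep v
      ... | true  = push
      ... | false = ret
      copyR : copyBack TR OR ⊢ σR (sep ∷ rights O) tr [] ⇒ tt ∣ σR (map key R ++ sep ∷ rights O) tr []
      copyR = subst (λ or → copyBack TR OR ⊢ σR (sep ∷ rights O) tr [] ⇒ tt ∣ σR or tr [])
        (reverse-keys R _)
        (copyBack-spec OR TR σR (λ _ _ _ → refl) (λ _ _ _ → refl) (λ _ _ _ → refl)
          (λ _ _ _ _ → refl) (λ _ _ _ _ → refl) (λ _ _ _ _ → refl) tr (sep ∷ rights O))

    spawns-spec : ∀ c u vs L R O →
      spawns c u vs ⊢ ⟨ w , z , y , map key (reverse L) , map key (reverse R) , O ⟩ ⇒ tt ∣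
                      ⟨ w , z , y , map key (reverse L) , map key (reverse R) , map (child c L u R) vs ++ O ⟩
    spawns-spec c u []       L R O = ret
    spawns-spec c u (v ∷ vs) L R O = spawns-spec c u vs L R O ⟫ spawn-spec c u v L R _

    branch-spec : ∀ c u k L R O →
      branch c u k ⊢ w ∷ z ∷ y ∷ controls O ∷ (map key L ++ sep ∷ lefts O) ∷ (map key R ++ sep ∷ rights O) ∷ [] ∷ [] ∷ [] ∷ []
      ⇒ tt ∣ ⟨ w , z , y , [] , [] , map (child c L u R) (choices c k) ++ O ⟩
    branch-spec c u k L R O = loadL ⟫ loadR ⟫ spawned ⟫ clearL ⟫ clearR
      where
      O′ = map (child c L u R) (choices c k) ++ O
      σL σR : Symbols → Symbols → Store
      σL ol t = w ∷ z ∷ y ∷ controls O ∷ ol ∷ (map key R ++ sep ∷ rights O) ∷ t ∷ [] ∷ [] ∷ []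
      σR or t = w ∷ z ∷ y ∷ controls O ∷ lefts O ∷ or ∷ reverse (map key L) ∷ t ∷ [] ∷ []
      loadL : load OL TL ⊢ σL (map key L ++ sep ∷ lefts O) [] ⇒ tt ∣ σL (lefts O) (reverse (map key L))
      loadL = sweep-until OL _ σL pushTo (λ _ _ → refl) (λ _ _ _ → refl)
                (keys (λ _ → refl , λ _ _ → push) L) refl []
      loadR : load OR TR ⊢ σR (map key R ++ sep ∷ rights O) [] ⇒ tt ∣ σR (rights O) (reverse (map key R))
      loadR = sweep-until OR _ σR pushTo (λ _ _ → refl) (λ _ _ _ → refl)
                (keys (λ _ → refl , λ _ _ → push) R) refl []
      spawned : spawns c u (choices c k) ⊢ ⟨ w , z , y , reverse (map key L) , reverse (map key R) , O ⟩ ⇒ tt ∣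
                ⟨ w , z , y , reverse (map key L) , reverse (map key R) , O′ ⟩
      spawned = subst₂ (λ tl tr → spawns c u (choices c k) ⊢ ⟨ w , z , y , tl , tr , O ⟩ ⇒ tt ∣ ⟨ w , z , y , tl , tr , O′ ⟩)
        (ListP.reverse-map key L) (ListP.reverse-map key R) (spawns-spec c u (choices c k) L R O)
      clearL : ∀ {tl tr} → clear TL ⊢ ⟨ w , z , y , tl , tr , O′ ⟩ ⇒ tt ∣ ⟨ w , z , y , [] , tr , O′ ⟩
      clearL {tl} {tr} = sweep-all TL _ (λ t _ → ⟨ w , z , y , t , tr , O′ ⟩) (λ _ _ → tt)
        (λ _ _ → refl) (λ _ _ _ → refl) (All.universal (λ _ → refl , λ _ _ → ret) tl) tt
      clearR : ∀ {tr} → clear TR ⊢ ⟨ w , z , y , [] , tr , O′ ⟩ ⇒ tt ∣ ⟨ w , z , y , [] , [] , O′ ⟩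
      clearR {tr} = sweep-all TR _ (λ t _ → ⟨ w , z , y , [] , t , O′ ⟩) (λ _ _ → tt)
        (λ _ _ → refl) (λ _ _ _ → refl) (All.universal (λ _ → refl , λ _ _ → ret) tr) tt

    pushKeys-spec : ∀ vs {oc ol or tl tr u} →
      pushKeys OR vs ⊢ w ∷ z ∷ y ∷ oc ∷ ol ∷ or ∷ tl ∷ tr ∷ u ∷ [] ⇒ tt ∣
                       w ∷ z ∷ y ∷ oc ∷ ol ∷ (map key vs ++ or) ∷ tl ∷ tr ∷ u ∷ []
    pushKeys-spec []       = ret
    pushKeys-spec (v ∷ vs) = pushKeys-spec vs ⟫ push

    next-symbols : ∀ L (xs : Symbols) → map key L ʳ++ (map key pads ++ xs) ≡ map key (next L) ++ xs
    next-symbols L xs = begin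
      map key L ʳ++ (map key pads ++ xs)           ≡⟨ ListP.ʳ++-defn (map key L) ⟩
      reverse (map key L) ++ (map key pads ++ xs)  ≡⟨ sym (ListP.++-assoc (reverse (map key L)) _ _) ⟩
      (reverse (map key L) ++ map key pads) ++ xs  ≡⟨ cong (λ r → (r ++ map key pads) ++ xs) (sym (ListP.reverse-map key L)) ⟩
      (map key (reverse L) ++ map key pads) ++ xs  ≡⟨ cong (_++ xs) (sym (ListP.map-++ key (reverse L) pads)) ⟩
      map key (next L) ++ xs ∎
      where open ≡-Reasoning

    finish-spec : ∀ m L O →
      finish m ⊢ w ∷ z ∷ y ∷ controls O ∷ (map key L ++ sep ∷ lefts O) ∷ rights O ∷ [] ∷ [] ∷ [] ∷ []
      ⇒ tt ∣ ⟨ w , z , y , [] , [] , restart L m ++ O ⟩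
    finish-spec nothing L O = loadL ⟫ clearL
      where
      σL : Symbols → Symbols → Store
      σL ol t = w ∷ z ∷ y ∷ controls O ∷ ol ∷ rights O ∷ t ∷ [] ∷ [] ∷ []
      loadL : load OL TL ⊢ σL (map key L ++ sep ∷ lefts O) [] ⇒ tt ∣ σL (lefts O) (reverse (map key L))
      loadL = sweep-until OL _ σL pushTo (λ _ _ → refl) (λ _ _ _ → refl)
                (keys (λ _ → refl , λ _ _ → push) L) refl []
      clearL : ∀ {tl} → clear TL ⊢ ⟨ w , z , y , tl , [] , O ⟩ ⇒ tt ∣ ⟨ w , z , y , [] , [] , O ⟩
      clearL {tl} = sweep-all TL _ (λ t _ → ⟨ w , z , y , t , [] , O ⟩) (λ _ _ → tt)
        (λ _ _ → refl) (λ _ _ _ → refl) (All.universal (λ _ → refl , λ _ _ → ret) tl) tt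
    finish-spec (just c′) L O = push ⟫ pushKeys-spec pads ⟫ loadL ⟫ push ⟫ push
      where
      σ : Symbols → Symbols → Store
      σ ol or = w ∷ z ∷ y ∷ controls O ∷ ol ∷ or ∷ [] ∷ [] ∷ [] ∷ []
      loadL : load OL OR ⊢ σ (map key L ++ sep ∷ lefts O) (map key pads ++ sep ∷ rights O) ⇒ tt ∣
                           σ (lefts O) (map key (next L) ++ sep ∷ rights O)
      loadL = subst (λ or → load OL OR ⊢ σ (map key L ++ sep ∷ lefts O) (map key pads ++ sep ∷ rights O) ⇒ tt ∣ σ (lefts O) or)
        (next-symbols L _)
        (sweep-until OL _ σ pushTo (λ _ _ → refl) (λ _ _ _ → refl)
          (keys (λ _ → refl , λ _ _ → push) L) refl _)

    serve-spec : ∀ k O → serve k ⊢ ⟨ w , z , y , [] , [] , O ⟩ ⇒ tt ∣ ⟨ w , z , y , [] , [] , work O k ⟩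
    serve-spec k []                    = pop-[] refl ⟫ ret
    serve-spec k ((c , L , u ∷ R) ∷ O) = pop-∷ refl ⟫ (pop-∷ refl ⟫ branch-spec c u k L R O)
    serve-spec k ((c , L , []) ∷ O)    = pop-∷ refl ⟫ (pop-∷ refl ⟫ finish-spec (out c) L O)

  serveDigit : Symbol → Prog ⊤
  serveDigit (dig d) = serve (digit d)
  serveDigit _       = ret tt

  -- The digits that the carry resets wait on TL until they are poured back onto Z.
  carry-body : ⊤ → Prog (⊤ ⊎ ⊤)
  carry-body _ = pop Z >>= λ
    { (just (dig d)) → maybe′ (λ d′ → push Z (dig d′) >> ret (inj₂ tt))
                              (push TL (dig zero) >> ret (inj₁ tt)) (succ? d)
    ; _              → push Z (dig zero) >> ret (inj₂ tt) }

  advanceZ : Prog ⊤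
  advanceZ = iter carry-body tt >> pour TL Z

  -- W has the last letter on top, so copying puts the word on OR in its proper order. The
  -- certificate on Y is the counter reversed, which is harmless because the counter runs through
  -- all lists.
  setup : Prog ⊤
  setup = push OR sep >> pushKeys OR pads >> copyBack W OR >> push OL sep >> push OC (ctl c₀) >> copyBack Z Y

  verdict : Maybe Symbol → Prog Bool
  verdict nothing  = ret true
  verdict (just _) = clear OC >> clear OL >> clear OR >> advanceZ >> ret false

  check : Prog Bool
  check = setup >> sweep never Y serveDigit >> (pop OC >>= verdict)

  module _ (w : Symbols) where

    carry-spec : ∀ ds t → ∃ λ z → ∃ λ t′ → t′ ʳ++ z ≡ t ʳ++ map dig (increment ds) ×
      (iter carry-body tt ⊢ ⟨ w , map dig ds , [] , t , [] , [] ⟩ ⇒ tt ∣ ⟨ w , z , [] , t′ , [] , [] ⟩)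
    carry-spec []       t = _ , _ , refl , leave (pop-[] refl ⟫ (push ⟫ ret))
    carry-spec (d ∷ ds) t with succ? d in e
    ... | just d′ = _ , _ , refl , leave (pop-∷ refl ⟫ go)
      where
      go : maybe′ (λ d′ → push Z (dig d′) >> ret (inj₂ tt)) (push TL (dig zero) >> ret (inj₁ tt)) (succ? d)
           ⊢ ⟨ w , map dig ds , [] , t , [] , [] ⟩ ⇒ inj₂ tt ∣ ⟨ w , map dig (d′ ∷ ds) , [] , t , [] , [] ⟩
      go rewrite e = push ⟫ ret
    ... | nothing with carry-spec ds (dig zero ∷ t)
    ... | z , t′ , eq , D = z , t′ , eq , again (pop-∷ refl ⟫ go) D
      where
      go : maybe′ (λ d′ → push Z (dig d′) >> ret (inj₂ tt)) (push TL (dig zero) >> ret (inj₁ tt)) (succ? d)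
           ⊢ ⟨ w , map dig ds , [] , t , [] , [] ⟩ ⇒ inj₁ tt ∣ ⟨ w , map dig ds , [] , dig zero ∷ t , [] , [] ⟩
      go rewrite e = push ⟫ ret

    advanceZ-spec : ∀ ds → advanceZ ⊢ ⟨ w , map dig ds , [] , [] , [] , [] ⟩ ⇒ tt ∣
                                      ⟨ w , map dig (increment ds) , [] , [] , [] , [] ⟩
    advanceZ-spec ds with carry-spec ds []
    ... | z , t , eq , D = D ⟫
      subst (λ z′ → pour TL Z ⊢ ⟨ w , z , [] , t , [] , [] ⟩ ⇒ tt ∣ ⟨ w , z′ , [] , [] , [] , [] ⟩) eq
        (sweep-all TL _ (λ t z → ⟨ w , z , [] , t , [] , [] ⟩) pushTo (λ _ _ → refl) (λ _ _ _ → refl)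
          (All.universal (λ _ → refl , λ _ _ → push) t) z)

    verdict-spec : ∀ ds O → ∃ λ s → (pop OC >>= verdict ⊢ ⟨ w , map dig ds , [] , [] , [] , O ⟩ ⇒ null O ∣ s) ×
                   (null O ≡ false → s ≡ ⟨ w , map dig (increment ds) , [] , [] , [] , [] ⟩)
    verdict-spec ds []      = _ , pop-[] refl ⟫ ret , λ ()
    verdict-spec ds (t ∷ O) = _ ,
      pop-∷ refl ⟫ (cleared OC (controls O) (λ xs → w ∷ map dig ds ∷ [] ∷ xs ∷ lefts (t ∷ O) ∷ rights (t ∷ O) ∷ [] ∷ [] ∷ [] ∷ [])
                       (λ _ → refl) (λ _ _ → refl)
                  ⟫ cleared OL (lefts (t ∷ O)) (λ xs → w ∷ map dig ds ∷ [] ∷ [] ∷ xs ∷ rights (t ∷ O) ∷ [] ∷ [] ∷ [] ∷ [])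
                       (λ _ → refl) (λ _ _ → refl)
                  ⟫ cleared OR (rights (t ∷ O)) (λ xs → w ∷ map dig ds ∷ [] ∷ [] ∷ [] ∷ xs ∷ [] ∷ [] ∷ [] ∷ [])
                       (λ _ → refl) (λ _ _ → refl)
                  ⟫ advanceZ-spec ds ⟫ ret) ,
      λ _ → refl
      where
      cleared : ∀ i seg (σ : Symbols → Store) → (∀ xs → lookup (σ xs) i ≡ xs) →
                (∀ xs ys → σ xs [ i ]≔ ys ≡ σ ys) → clear i ⊢ σ seg ⇒ tt ∣ σ []
      cleared i seg σ get set = sweep-all i _ (λ xs _ → σ xs) (λ _ _ → tt) (λ xs _ → get xs) (λ xs _ → set xs)
        (All.universal (λ _ → refl , λ _ _ → ret) seg) tt

    work-spec : ∀ z ds O → sweep never Y serveDigit ⊢ ⟨ w , z , map dig ds , [] , [] , O ⟩ ⇒ tt ∣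
                           ⟨ w , z , [] , [] , [] , foldl work O (map digit ds) ⟩
    work-spec z ds O =
      subst (λ O′ → sweep never Y serveDigit ⊢ ⟨ w , z , map dig ds , [] , [] , O ⟩ ⇒ tt ∣ ⟨ w , z , [] , [] , [] , O′ ⟩)
        (fold ds O)
        (sweep-all Y serveDigit (λ y O → ⟨ w , z , y , [] , [] , O ⟩) serveTask (λ _ _ → refl) (λ _ _ _ → refl)
          (AllP.map⁺ (All.universal (λ d → refl , λ y O → serve-spec w z y (digit d) O) ds)) O)
      where
      serveTask : List Task → Symbol → List Task
      serveTask O (dig d) = work O (digit d)
      serveTask O _       = O
      fold : ∀ ds O → foldl serveTask O (map dig ds) ≡ foldl work O (map digit ds)
      fold []       O = refl
      fold (d ∷ ds) O = fold ds (work O (digit d))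

  wordStack : List (Fin s) → Symbols
  wordStack w = reverse (map (key ∘ letter) w)

  task : List (Fin s) → Task
  task w = c₀ , [] , map letter w ++ pads

  reverse-digits : ∀ ds → reverse (map dig ds) ≡ map dig (reverse ds)
  reverse-digits ds = sym (ListP.reverse-map dig ds)

  setup-spec : ∀ w ds → setup ⊢ ⟨ wordStack w , map dig ds , [] , [] , [] , [] ⟩ ⇒ tt ∣
                        ⟨ wordStack w , map dig ds , map dig (reverse ds) , [] , [] , [ task w ] ⟩
  setup-spec w ds = push ⟫ pushKeys-spec W₀ D [] pads ⟫ copyW ⟫ push ⟫ push ⟫ copyZ
    where
    W₀ = wordStack w
    D = map dig ds
    σW σZ : Symbols → Symbols → Symbols → Store
    σW or x u = x ∷ D ∷ [] ∷ [] ∷ [] ∷ or ∷ [] ∷ [] ∷ u ∷ []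
    σZ y z u = W₀ ∷ z ∷ y ∷ controls [ task w ] ∷ lefts [ task w ] ∷ rights [ task w ] ∷ [] ∷ [] ∷ u ∷ []
    letters : W₀ ʳ++ (map key pads ++ [ sep ]) ≡ map key (map letter w ++ pads) ++ [ sep ]
    letters = begin
      W₀ ʳ++ (map key pads ++ [ sep ])                    ≡⟨ ListP.ʳ++-defn W₀ ⟩
      reverse W₀ ++ (map key pads ++ [ sep ])             ≡⟨ cong (_++ _) (ListP.reverse-involutive (map (key ∘ letter) w)) ⟩
      map (key ∘ letter) w ++ (map key pads ++ [ sep ])   ≡⟨ cong (_++ _) (ListP.map-∘ w) ⟩
      map key (map letter w) ++ (map key pads ++ [ sep ]) ≡⟨ sym (ListP.++-assoc (map key (map letter w)) _ _) ⟩
      (map key (map letter w) ++ map key pads) ++ [ sep ] ≡⟨ cong (_++ _) (sym (ListP.map-++ key (map letter w) pads)) ⟩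
      map key (map letter w ++ pads) ++ [ sep ] ∎
      where open ≡-Reasoning
    copyW : copyBack W OR ⊢ σW (map key pads ++ [ sep ]) W₀ [] ⇒ tt ∣ σW (rights [ task w ]) W₀ []
    copyW = subst (λ or → copyBack W OR ⊢ σW (map key pads ++ [ sep ]) W₀ [] ⇒ tt ∣ σW or W₀ [])
      letters
      (copyBack-spec OR W σW (λ _ _ _ → refl) (λ _ _ _ → refl) (λ _ _ _ → refl)
        (λ _ _ _ _ → refl) (λ _ _ _ _ → refl) (λ _ _ _ _ → refl) W₀ _)
    copyZ : copyBack Z Y ⊢ σZ [] D [] ⇒ tt ∣ σZ (map dig (reverse ds)) D []
    copyZ = subst (λ y → copyBack Z Y ⊢ σZ [] D [] ⇒ tt ∣ σZ y D [])
      (reverse-digits ds)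
      (copyBack-spec Y Z σZ (λ _ _ _ → refl) (λ _ _ _ → refl) (λ _ _ _ → refl)
        (λ _ _ _ _ → refl) (λ _ _ _ _ → refl) (λ _ _ _ _ → refl) D [])

  open Search 8 Symbol (key ∘ letter) using (machine; search)

  checkable : ∃ λ (T : TM s) → ∀ w → HaltsOn T w ⇔ ∃ λ zs → foldl work [ task w ] zs ≡ []
  checkable = machine check , λ w → mk⇔
    (λ h → sound w (Equivalence.to (searches w) h)) (λ c → Equivalence.from (searches w) (complete w c))
    where
    left-over : List (Fin s) → ℕ → List Task
    left-over w n = foldl work [ task w ] (map digit (reverse (count n)))
    σ : List (Fin s) → ℕ → Store
    σ w n = ⟨ wordStack w , map dig (count n) , [] , [] , [] , [] ⟩
    round : ∀ w n → ∃ λ s → (check ⊢ σ w n ⇒ null (left-over w n) ∣ s) ×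
                            (null (left-over w n) ≡ false → s ≡ σ w (suc n))
    round w n with verdict-spec (wordStack w) (count n) (left-over w n)
    ... | s , D , e = s , setup-spec w (count n) ⟫ work-spec (wordStack w) _ (reverse (count n)) [ task w ] ⟫ D , e
    searches : ∀ w → HaltsOn (machine check) w ⇔ ∃ λ n → null (left-over w n) ≡ true
    searches w = search check w (σ w) (null ∘ left-over w) refl (round w)
    null-[] : ∀ {O : List Task} → null O ≡ true → O ≡ []
    null-[] {[]} refl = refl
    sound : ∀ w → (∃ λ n → null (left-over w n) ≡ true) → ∃ λ zs → foldl work [ task w ] zs ≡ []
    sound w (n , e) = map digit (reverse (count n)) , null-[] e
    complete : ∀ w → (∃ λ zs → foldl work [ task w ] zs ≡ []) → ∃ λ n → null (left-over w n) ≡ true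
    complete w (zs , e) with digit-surjective zs
    ... | ds , refl with count-surjective (reverse ds)
    ... | n , e′ = n , cong null (trans (cong (λ ds → foldl work [ task w ] (map digit ds))
                                      (trans (cong reverse e′) (ListP.reverse-involutive ds))) e)

RecEnum-⇔ : {s : ℕ} {L P : List (Fin s) → Set} → (∃ λ (T : TM s) → ∀ w → HaltsOn T w ⇔ P w) →
            (∀ w → L w ⇔ P w) → RecEnum L
RecEnum-⇔ (T , e) h = T , λ w → ⇔-sym (e w) ⇔-∘ h w

module _ {s : ℕ} (M : AARM s) where

  open AARM M
  open Game M

  private
    module Check = Checker ⦃ finiteC ⦄ δ ex out is-just (replicate N nothing) anke₀ nothing (just ∘ ι)

    task-won : ∀ w → Accepts M w ⇔ ∃ λ zs → foldl work [ Check.task w ] zs ≡ []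
    task-won w =
      subst (λ R → Win anke₀ [] (padded (embed M w) N) ⇔ ∃ λ zs → foldl work [ anke₀ , [] , R ] zs ≡ [])
        (cong (_++ replicate N nothing) (sym (ListP.map-∘ w)))
        (win⇔certificate nothing)
      ⇔-∘ game (embed M w)

  recognised-RecEnum : {L : List (Fin s) → Set} → (∀ w → L w ⇔ Accepts M w) → RecEnum L
  recognised-RecEnum h = RecEnum-⇔ Check.checkable (λ w → task-won w ⇔-∘ h w)

theorem3 : ∀ (s : ℕ) (L : List (Fin s) → Set) →
    RecEnum L ⇔ (∃ λ (M : AARM s) → ∀ w → L w ⇔ Accepts M w)
theorem3 s L = mk⇔
  (λ (T , h) → Simulation.simulator T , λ w → Simulation.halts⇔accepts T w ⇔-∘ h w)
  (λ (M , h) → recognised-RecEnum M h)
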